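{- Let $n\ge 2$ and let $K_n^*$ be the complete graph $K_n$ rooted at a vertex $r$, whose automorphism group is $E_1\times S_{n-1}$ (all permutations of the vertices fixing $r$). For a divisor $d$ of $n-1$, the number $i_d$ of unlabeled imbeddings of $K_n^*$ that are $d$-fold symmetric, i.e. whose map-automorphism group is cyclic of order $d$ (the group $E_1\times C_d[E_{(n-1)/d}]$: fixing $r$ and generated by a permutation whose cycles on the other $n-1$ vertices all have length $d$), is \[ i_d=d\sum_{k:\ d\mid k,\ k\mid n-1}\mu(k/d)\,\frac{((n-2)!)^{(n-1)/k}}{n-1},\] where $\mu$ is the Möbius function.
   Context: A rotation at a vertex $v$ is a cyclic permutation of its neighborhood $N(v)$ (a single cycle through all of $N(v)$); a map is $M=(K_n,\rho)$ with $\rho=\{\rho_v\}$ a rotation system (maps correspond to labeled 2-cell imbeddings in oriented surfaces). The group $E_1\times S_{n-1}$ acts on maps by $\rho\mapsto\rho'$ with $\rho'_{\gamma(v)}=\gamma\rho_v\gamma^{ -1}$; the stabilizer of $M$ in this group is its map-automorphism group, and the orbits of maps are the unlabeled imbeddings of $K_n^*$. -}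

module Defs where

open import Data.Nat using (ℕ; zero; suc; _!; _+_; _*_; _∸_; _^_; _≤_; _<_; _≟_)
open import Data.Nat.Divisibility using (_∣_; _∣?_)
open import Data.Nat.DivMod using (_/_)
open import Data.Nat.Primality using (prime?)

open import Data.Integer as ℤ using (ℤ; +_; -_)
open import Data.Fin using (Fin)
open import Data.Fin.Permutation using (Permutation′; _⟨$⟩ʳ_; _⟨$⟩ˡ_)
open import Data.List using (List; []; _∷_; length; filter; map; upTo; foldr)
open import Data.List.Relation.Unary.All using (All)
open import Data.List.Relation.Unary.Any using (Any)
open import Data.List.Relation.Unary.AllPairs using (AllPairs)
open import Data.Product using (Σ; ∃; ∃-syntax; _×_; proj₁)
open import Relation.Binary.PropositionalEquality using (_≡_; _≢_)
open import Relation.Nullary using (¬_)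
open import Relation.Nullary.Decidable using (_×-dec_; ¬?)

-- natural division with the convention m div 0 = 0 (only used with d ≥ 1)
_div_ : ℕ → ℕ → ℕ
m div zero    = zero
m div (suc d) = m / suc d

range1 : ℕ → List ℕ
range1 m = map suc (upTo m)

sumℤ : List ℤ → ℤ
sumℤ = foldr ℤ._+_ (+ 0)

-- Möbius function: μ(m) = 0 if p² ∣ m for some prime p (equivalently some
-- k ≥ 2 with k² ∣ m), otherwise (-1)^(number of distinct primes dividing m).
-- (μ 0 is irrelevant; it is only applied to positive arguments.)
primeDivisors : ℕ → List ℕ
primeDivisors m = filter (λ p → prime? p ×-dec p ∣? m) (range1 m)

squareDivisors : ℕ → List ℕ
squareDivisors m = filter (λ k → k * k ∣? m) (map (λ i → suc (suc i)) (upTo m))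

μ : ℕ → ℤ
μ m with squareDivisors m
... | _ ∷ _ = + 0
... | []    = (- + 1) ℤ.^ length (primeDivisors m)

-- Maps of K_n: vertices Fin n, N(v) = all vertices other than v.

iter : {A : Set} → (A → A) → ℕ → A → A
iter f zero    x = x
iter f (suc k) x = f (iter f k x)

-- ρ v is the rotation at v, a cyclic permutation of N(v); as a function on
-- all of Fin n it is normalised to fix v itself.
record IsRotationSystem (n : ℕ) (ρ : Fin n → Fin n → Fin n) : Set where
  field
    fixes-centre : ∀ v → ρ v v ≡ v
    injective    : ∀ v x y → ρ v x ≡ ρ v y → x ≡ y
    single-cycle : ∀ v u w → u ≢ v → w ≢ v → ∃[ k ] iter (ρ v) k u ≡ w

Map : ℕ → Set
Map n = Σ (Fin n → Fin n → Fin n) (IsRotationSystem n)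

rot : ∀ {n} → Map n → Fin n → Fin n → Fin n
rot = proj₁

act : ∀ {n} → Permutation′ n → (Fin n → Fin n → Fin n) → Fin n → Fin n → Fin n
act γ ρ w x = γ ⟨$⟩ʳ ρ (γ ⟨$⟩ˡ w) (γ ⟨$⟩ˡ x)

FixesRoot : ∀ {n} → Fin n → Permutation′ n → Set
FixesRoot r γ = γ ⟨$⟩ʳ r ≡ r

-- M and M' lie in the same orbit (same unlabeled imbedding of K_n^*)
Equivalent : ∀ {n} → Fin n → Map n → Map n → Set
Equivalent r M M' = ∃[ γ ] FixesRoot r γ × (∀ w x → rot M' w x ≡ act γ (rot M) w x)

IsAut : ∀ {n} → Fin n → Map n → Permutation′ n → Set
IsAut r M γ = FixesRoot r γ × (∀ w x → act γ (rot M) w x ≡ rot M w x)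

DFoldSymmetric : ∀ {n} → Fin n → ℕ → Map n → Set
DFoldSymmetric r d M =
  ∃[ g ] IsAut r M g
    × (∀ γ → IsAut r M γ → ∃[ j ] (∀ x → γ ⟨$⟩ʳ x ≡ iter (g ⟨$⟩ʳ_) j x))
    × (∀ v → v ≢ r → iter (g ⟨$⟩ʳ_) d v ≡ v
                     × (∀ j → 0 < j → j < d → iter (g ⟨$⟩ʳ_) j v ≢ v))

record IsOrbitTransversal {n} (r : Fin n) (d : ℕ) (L : List (Map n)) : Set where
  field
    members-sym  : All (DFoldSymmetric r d) L
    inequivalent : AllPairs (λ M M' → ¬ Equivalent r M M') L
    covering     : ∀ M → DFoldSymmetric r d M → Any (Equivalent r M) L

mobiusSum : ℕ → ℕ → ℤ
mobiusSum n d =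
  + d ℤ.* sumℤ (map (λ k → μ (k div d) ℤ.* + (((n ∸ 2) !) ^ ((n ∸ 1) div k)))
                   (filter (λ k → d ∣? k ×-dec k ∣? (n ∸ 1)) (range1 (n ∸ 1))))

{-# OPTIONS --safe #-}
module Submission where

-- For v ≠ r the rotation at r labels every vertex relative to v: r gets label 0 and ρᵣʲ v gets label
-- j + 1.  In these labels the rotation at v becomes one of the (n − 2)! cyclic orders of the
-- neighbours, its letter, and since all (n − 1)-cycles are conjugate, a map is determined up to
-- isomorphism by ρᵣ and its letters.  Reading the letters along v, ρᵣ v, ρᵣ² v, … gives a word of
-- length n − 1; changing v rotates the word.  So unlabeled imbeddings are necklaces of length n − 1
-- over (n − 2)! letters, an automorphism is a power of ρᵣ (off r) fixing the word, and d-fold symmetry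
-- means that the word has least period (n − 1)/d.  Such words are counted by Möbius inversion, and
-- each necklace contains (n − 1)/d of them.

open import Defs

open import Data.Fin using (Fin; zero; suc; toℕ; fromℕ<; finToFun; funToFin; combine; remQuot; punchIn; punchOut)
open import Data.Fin.Permutation as Perm
  using (Permutation′; permutation; _⟨$⟩ʳ_; _⟨$⟩ˡ_; inverseˡ; inverseʳ; insert; remove; swap; transpose; lift₀; _∘ₚ_; flip)
import Data.Fin.Properties as Finₚ
open import Data.Integer as ℤ using (ℤ; +_; -_)
import Data.Integer.Properties as ℤₚ
open import Data.List using (List; []; _∷_; length; filter; map; upTo; concatMap; allFin)
open import Data.List.Membership.Propositional using (_∈_)
open import Data.List.Membership.Propositional.Properties
  using (∈-map⁺; ∈-map⁻; ∈-filter⁺; ∈-filter⁻; ∈-upTo⁺; ∈-concatMap⁺; ∈-concatMap⁻; ∈-allFin)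
open import Data.List.Membership.Propositional.Properties.WithK using (unique∧set⇒bag)
open import Data.List.Properties using (length-map; length-upTo; length-++; length-tabulate; map-∘)
open import Data.List.Relation.Binary.BagAndSetEquality using (∼bag⇒↭)
open import Data.List.Relation.Binary.Permutation.Propositional as ↭ using (_↭_)
import Data.List.Relation.Binary.Permutation.Propositional.Properties as ↭ₚ
open import Data.List.Relation.Unary.All as All using (All; []; _∷_)
import Data.List.Relation.Unary.All.Properties as Allₚ
open import Data.List.Relation.Unary.AllPairs as AllPairs using (AllPairs; []; _∷_)
import Data.List.Relation.Unary.AllPairs.Properties as AllPairsₚ
open import Data.List.Relation.Unary.Any as Any using (Any; here; there)
import Data.List.Relation.Unary.Any.Properties as Anyₚ
open import Data.List.Relation.Unary.Unique.Propositional using (Unique)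
import Data.List.Relation.Unary.Unique.Propositional.Properties as Unique
open import Data.Nat as ℕ using (ℕ; zero; suc; _+_; _*_; _∸_; _^_; _!; _≤_; _<_; z≤n; s≤s; NonZero)
open import Data.Nat.Coprimality using (coprime-divisor)
open import Data.Nat.Divisibility
open import Data.Nat.DivMod
  using (_/_; _%_; m%n<n; m%n≤n; m≡m%n+[m/n]*n; m*n/n≡m; m<n⇒m%n≡m; n%n≡0; [m+n]%n≡m%n; %-distribˡ-+; m%n%n≡m%n)
open import Data.Nat.ListAction using (product)
open import Data.Nat.Primality using (Prime; prime?; euclidsLemma; prime⇒nonZero; prime⇒nonTrivial; prime⇒irreducible)
open import Data.Nat.Primality.Factorisation using (factorise)
import Data.Nat.Properties as ℕₚ
open import Data.Product using (Σ; ∃; ∃-syntax; _×_; _,_; proj₁; proj₂; uncurry)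
open import Data.Sum using (_⊎_; inj₁; inj₂; reduce)
open import Function using (_∘_; mk⇔)
open import Level using (0ℓ)
open import Relation.Binary.Definitions as Binary using (DecidableEquality; Reflexive; Symmetric; Transitive)
open import Relation.Binary.PropositionalEquality
  using (_≡_; _≢_; _≗_; refl; sym; trans; cong; cong₂; subst; subst₂; module ≡-Reasoning)
open import Relation.Nullary using (¬_; Dec; yes; no; contradiction)
open import Relation.Nullary.Decidable using (_×-dec_; ¬?; map′)
open import Relation.Unary using (Pred; Decidable)

-- Finite sums and the Möbius function

-- Möbius inversion is applied not to the least period p of a word but to its number of symmetries
-- (n - 1)/p: k divides that number exactly when rotation by (n - 1)/k places fixes the word. Hence
-- the sum over multiples k of d, with words of length (n - 1)/k counted in each term. The factor d
-- appears because n - 1 = q d with q = (n - 1)/d, and q times the number of necklaces is the number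
-- of words of least period q.
--
-- Letters at different vertices can be compared because labels are relative: the vertex itself
-- always has label 1 and the root label 0, so every rotation becomes a cycle around 1 on one fixed
-- set. An isomorphism fixing r commutes with the rotations at r, hence respects labels and
-- preserves letters.
--
-- The generator supplied by d-fold symmetry is arbitrary and need not act as ρᵣ^q; it has to be
-- compared with the automorphism that the least period provides.
--
-- Words are stored in `Fin (K ^ m)`, where equality is decidable and pointwise equality is
-- equality, and read as periodic sequences, where rotation is a shift. In the parts on orbits and
-- words m is the word length; in those on maps the word length is `suc m`.

unique-↭ : {A : Set} {xs ys : List A} → Unique xs → Unique ys →
           (∀ {x} → x ∈ xs → x ∈ ys) → (∀ {x} → x ∈ ys → x ∈ xs) → xs ↭ ys
unique-↭ uxs uys f g = ∼bag⇒↭ (unique∧set⇒bag uxs uys (mk⇔ f g))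

∑ : {A : Set} → (A → ℤ) → List A → ℤ
∑ f xs = sumℤ (map f xs)

sumℤ-↭ : ∀ {xs ys} → xs ↭ ys → sumℤ xs ≡ sumℤ ys
sumℤ-↭ ↭.refl = refl
sumℤ-↭ (↭.prep x p) = cong (ℤ._+_ x) (sumℤ-↭ p)
sumℤ-↭ (↭.swap {xs} {ys} x y p) = begin
  x ℤ.+ (y ℤ.+ sumℤ xs)  ≡⟨ cong (λ s → x ℤ.+ (y ℤ.+ s)) (sumℤ-↭ p) ⟩
  x ℤ.+ (y ℤ.+ sumℤ ys)  ≡⟨ ℤₚ.+-assoc x y _ ⟨
  x ℤ.+ y ℤ.+ sumℤ ys    ≡⟨ cong (ℤ._+ sumℤ ys) (ℤₚ.+-comm x y) ⟩
  y ℤ.+ x ℤ.+ sumℤ ys    ≡⟨ ℤₚ.+-assoc y x _ ⟩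
  y ℤ.+ (x ℤ.+ sumℤ ys)  ∎
  where open ≡-Reasoning
sumℤ-↭ (↭.trans p q) = trans (sumℤ-↭ p) (sumℤ-↭ q)

∑-↭ : {A : Set} (f : A → ℤ) {xs ys : List A} → xs ↭ ys → ∑ f xs ≡ ∑ f ys
∑-↭ f p = sumℤ-↭ (↭ₚ.map⁺ f p)

∑-map : {A B : Set} (f : B → ℤ) (g : A → B) (xs : List A) → ∑ f (map g xs) ≡ ∑ (f ∘ g) xs
∑-map f g xs = cong sumℤ (sym (map-∘ xs))

∑-cong-∈ : {A : Set} {f g : A → ℤ} (xs : List A) → (∀ {x} → x ∈ xs → f x ≡ g x) → ∑ f xs ≡ ∑ g xs
∑-cong-∈ []       e = refl
∑-cong-∈ (x ∷ xs) e = cong₂ ℤ._+_ (e (here refl)) (∑-cong-∈ xs (e ∘ there))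

∑-0 : {A : Set} (xs : List A) → ∑ (λ _ → + 0) xs ≡ + 0
∑-0 []       = refl
∑-0 (x ∷ xs) = trans (ℤₚ.+-identityˡ _) (∑-0 xs)

∑-neg : {A : Set} (f : A → ℤ) (xs : List A) → ∑ (λ x → - f x) xs ≡ - ∑ f xs
∑-neg f []       = refl
∑-neg f (x ∷ xs) = trans (cong (ℤ._+_ (- f x)) (∑-neg f xs)) (sym (ℤₚ.neg-distrib-+ (f x) _))

+-interchange : ∀ a b c d → (a ℤ.+ b) ℤ.+ (c ℤ.+ d) ≡ (a ℤ.+ c) ℤ.+ (b ℤ.+ d)
+-interchange = interchange
  where open import Algebra.Properties.CommutativeSemigroup ℤₚ.+-commutativeSemigroup using (interchange)

∑-+ : {A : Set} (f g : A → ℤ) (xs : List A) → ∑ (λ x → f x ℤ.+ g x) xs ≡ ∑ f xs ℤ.+ ∑ g xs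
∑-+ f g []       = refl
∑-+ f g (x ∷ xs) = trans (cong (ℤ._+_ (f x ℤ.+ g x)) (∑-+ f g xs)) (+-interchange (f x) (g x) _ _)

∑-*ˡ : {A : Set} (c : ℤ) (f : A → ℤ) (xs : List A) → ∑ (λ x → c ℤ.* f x) xs ≡ c ℤ.* ∑ f xs
∑-*ˡ c f []       = sym (ℤₚ.*-zeroʳ c)
∑-*ˡ c f (x ∷ xs) = trans (cong (ℤ._+_ (c ℤ.* f x)) (∑-*ˡ c f xs)) (sym (ℤₚ.*-distribˡ-+ c (f x) _))

∑-exchange : {A B : Set} (f : A → B → ℤ) (xs : List A) (ys : List B) →
             ∑ (λ x → ∑ (f x) ys) xs ≡ ∑ (λ y → ∑ (λ x → f x y) xs) ys
∑-exchange f []       ys = sym (∑-0 ys)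
∑-exchange f (x ∷ xs) ys = trans (cong (ℤ._+_ (∑ (f x) ys)) (∑-exchange f xs ys))
                                   (sym (∑-+ (f x) _ ys))

𝟙 : ∀ {ℓ} {P : Set ℓ} → Dec P → ℤ
𝟙 (yes _) = + 1
𝟙 (no  _) = + 0

∑-𝟙 : {A : Set} {P : Pred A 0ℓ} (P? : Decidable P) (xs : List A) →
      ∑ (λ x → 𝟙 (P? x)) xs ≡ + length (filter P? xs)
∑-𝟙 P? []       = refl
∑-𝟙 P? (x ∷ xs) with P? x
... | yes _ = cong (ℤ._+_ (+ 1)) (∑-𝟙 P? xs)
... | no  _ = trans (ℤₚ.+-identityˡ _) (∑-𝟙 P? xs)

∑-filter : {A : Set} {P : Pred A 0ℓ} (P? : Decidable P) (f : A → ℤ) (xs : List A) →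
           ∑ f (filter P? xs) ≡ ∑ (λ x → 𝟙 (P? x) ℤ.* f x) xs
∑-filter P? f []       = refl
∑-filter P? f (x ∷ xs) with P? x
... | yes _ = cong₂ ℤ._+_ (sym (ℤₚ.*-identityˡ (f x))) (∑-filter P? f xs)
... | no  _ = trans (∑-filter P? f xs) (sym (ℤₚ.+-identityˡ _))

∑-split : {A : Set} {P : Pred A 0ℓ} (P? : Decidable P) (f : A → ℤ) (xs : List A) →
          ∑ f xs ≡ ∑ f (filter P? xs) ℤ.+ ∑ f (filter (¬? ∘ P?) xs)
∑-split P? f []       = refl
∑-split P? f (x ∷ xs) with P? x
... | yes _ = trans (cong (ℤ._+_ (f x)) (∑-split P? f xs)) (sym (ℤₚ.+-assoc (f x) _ _))
... | no  _ = begin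
  f x ℤ.+ ∑ f xs               ≡⟨ cong (ℤ._+_ (f x)) (∑-split P? f xs) ⟩
  f x ℤ.+ (s ℤ.+ t)            ≡⟨ ℤₚ.+-assoc (f x) s t ⟨
  f x ℤ.+ s ℤ.+ t              ≡⟨ cong (ℤ._+ t) (ℤₚ.+-comm (f x) s) ⟩
  s ℤ.+ f x ℤ.+ t              ≡⟨ ℤₚ.+-assoc s (f x) t ⟩
  s ℤ.+ (f x ℤ.+ t)            ∎
  where
  open ≡-Reasoning
  s = ∑ f (filter P? xs)
  t = ∑ f (filter (¬? ∘ P?) xs)

range1-Unique : ∀ m → Unique (range1 m)
range1-Unique m = Unique.map⁺ ℕₚ.suc-injective (Unique.upTo⁺ m)

∈-range1⁺ : ∀ {m k} .{{_ : NonZero k}} → k ≤ m → k ∈ range1 m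
∈-range1⁺ {k = suc k} k<m = ∈-map⁺ suc (∈-upTo⁺ k<m)

-- Divisors, square factors and values of the Möbius function.

divisors : ℕ → List ℕ
divisors n = filter (_∣? n) (range1 n)

divisors-Unique : ∀ n → Unique (divisors n)
divisors-Unique n = Unique.filter⁺ (_∣? n) (range1-Unique n)

∣⇒nonZero : ∀ {d n} .{{_ : NonZero n}} → d ∣ n → NonZero d
∣⇒nonZero {zero}  {suc _} 0∣n = contradiction (0∣⇒≡0 0∣n) λ ()
∣⇒nonZero {suc _} d∣n = _

∈-divisors⁺ : ∀ {d n} .{{_ : NonZero n}} → d ∣ n → d ∈ divisors n
∈-divisors⁺ {d} {n} d∣n = ∈-filter⁺ (_∣? n) (∈-range1⁺ {{∣⇒nonZero d∣n}} (∣⇒≤ d∣n)) d∣n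

∈-divisors⁻ : ∀ {d n} → d ∈ divisors n → d ∣ n
∈-divisors⁻ {n = n} d∈ = proj₂ (∈-filter⁻ (_∣? n) {xs = range1 n} d∈)

SquareFree : ℕ → Set
SquareFree n = ∀ k → 2 ≤ k → ¬ k * k ∣ n

∈-squareDivisors⁺ : ∀ {k n} .{{_ : NonZero n}} → 2 ≤ k → k * k ∣ n → k ∈ squareDivisors n
∈-squareDivisors⁺ {suc (suc k)} {n} (s≤s (s≤s z≤n)) kk∣n =
  ∈-filter⁺ (λ k → k * k ∣? n) (∈-map⁺ (λ i → suc (suc i)) (∈-upTo⁺ k<n)) kk∣n
  where
  k<n : k < n
  k<n = ℕₚ.≤-trans (ℕₚ.≤-trans (ℕₚ.n≤1+n (suc k)) (ℕₚ.m≤m*n (2 + k) (2 + k))) (∣⇒≤ kk∣n)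

∈-squareDivisors⁻ : ∀ {k n} → k ∈ squareDivisors n → 2 ≤ k × k * k ∣ n
∈-squareDivisors⁻ {n = n} k∈
  with ∈-filter⁻ (λ k → k * k ∣? n) {xs = map (λ i → suc (suc i)) (upTo n)} k∈
... | k∈′ , kk∣n with ∈-map⁻ (λ i → suc (suc i)) k∈′
... | _ , _ , refl = s≤s (s≤s z≤n) , kk∣n

μ-square : ∀ {k n} .{{_ : NonZero n}} → 2 ≤ k → k * k ∣ n → μ n ≡ + 0
-- `μ` branches on `squareDivisors n`, so abstracting this list lets `μ` compute; the membership
-- fact abstracted with it excludes the empty list.
μ-square {n = n} 2≤k kk∣n with squareDivisors n | ∈-squareDivisors⁺ {n = n} 2≤k kk∣n
... | _ ∷ _ | _  = refl
... | []    | ()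

μ-squareFree : ∀ {n} → SquareFree n → μ n ≡ (- + 1) ℤ.^ length (primeDivisors n)
μ-squareFree {n} sf with squareDivisors n | (λ {k} → ∈-squareDivisors⁻ {k} {n})
... | []    | _   = refl
... | k ∷ _ | sq with sq (here refl)
...   | 2≤k , kk∣n = contradiction kk∣n (sf k 2≤k)

squareFree? : ∀ n .{{_ : NonZero n}} → (∃[ k ] 2 ≤ k × k * k ∣ n) ⊎ SquareFree n
squareFree? n with squareDivisors n | (λ {k} → ∈-squareDivisors⁻ {k} {n}) | (λ {k} → ∈-squareDivisors⁺ {k} {n})
... | []    | _  | all = inj₂ λ k 2≤k kk∣n → Anyₚ.¬Any[] (all 2≤k kk∣n)
... | k ∷ _ | sq | _   = inj₁ (k , sq (here refl))

module _ {p d} (p-prime : Prime p) (p∤d : p ∤ d) .{{_ : NonZero d}} where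
  private instance
    p≢0 : NonZero p
    p≢0 = prime⇒nonZero p-prime
    pd≢0 : NonZero (p * d)
    pd≢0 = ℕₚ.m*n≢0 p d

  -- If p ∣ k then p² ∣ p d, against p ∤ d; otherwise k² is coprime to p and already divides d.
  squareFree-prime-* : SquareFree d → SquareFree (p * d)
  squareFree-prime-* sf k 2≤k kk∣pd with p ∣? k
  ... | yes p∣k = p∤d (*-cancelˡ-∣ p (∣-trans (*-pres-∣ p∣k p∣k) kk∣pd))
  ... | no  p∤k = sf k 2≤k (coprime-divisor coprime kk∣pd)
    where
    coprime : ∀ {e} → e ∣ k * k × e ∣ p → e ≡ 1
    coprime (e∣kk , e∣p) with prime⇒irreducible p-prime e∣p
    ... | inj₁ e≡1 = e≡1
    ... | inj₂ refl = contradiction (reduce (euclidsLemma k k p-prime e∣kk)) p∤k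

  primeDivisors-prime-* : primeDivisors (p * d) ↭ p ∷ primeDivisors d
  primeDivisors-prime-* = unique-↭ (Unique.filter⁺ P? (range1-Unique (p * d)))
    (All.tabulate (λ q∈ p≡q → p∤d (subst (_∣ d) (sym p≡q) (proj₂ (proj₂ (∈-filter⁻ Q? {xs = range1 d} q∈)))))
      ∷ Unique.filter⁺ Q? (range1-Unique d))
    to from
    where
    P? = λ q → prime? q ×-dec q ∣? p * d
    Q? = λ q → prime? q ×-dec q ∣? d
    to : ∀ {q} → q ∈ primeDivisors (p * d) → q ∈ p ∷ primeDivisors d
    to q∈ with ∈-filter⁻ P? {xs = range1 (p * d)} q∈
    ... | _ , q-prime , q∣pd with euclidsLemma p d q-prime q∣pd
    ... | inj₂ q∣d = there (∈-filter⁺ Q? (∈-range1⁺ {{prime⇒nonZero q-prime}} (∣⇒≤ q∣d)) (q-prime , q∣d))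
    ... | inj₁ q∣p with prime⇒irreducible p-prime q∣p
    ...   | inj₁ refl = contradiction q-prime λ ()
    ...   | inj₂ q≡p    = here q≡p
    mk : ∀ {q} → Prime q → q ∣ p * d → q ∈ primeDivisors (p * d)
    mk q-prime q∣pd = ∈-filter⁺ P? (∈-range1⁺ {{prime⇒nonZero q-prime}} (∣⇒≤ q∣pd)) (q-prime , q∣pd)
    from : ∀ {q} → q ∈ p ∷ primeDivisors d → q ∈ primeDivisors (p * d)
    from (here refl) = mk p-prime (m∣m*n d)
    from (there q∈) with ∈-filter⁻ Q? {xs = range1 d} q∈
    ... | _ , q-prime , q∣d = mk q-prime (∣n⇒∣m*n p q∣d)

  -- A square factor of d makes both sides 0; in the square-free case p is one further prime divisor
  -- and flips the sign.
  μ-prime-* : μ (p * d) ≡ - μ d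
  μ-prime-* with squareFree? d
  ... | inj₁ (k , 2≤k , kk∣d) =
    trans (μ-square 2≤k (∣n⇒∣m*n p kk∣d)) (cong -_ (sym (μ-square 2≤k kk∣d)))
  ... | inj₂ sf = begin
    μ (p * d)                                        ≡⟨ μ-squareFree (squareFree-prime-* sf) ⟩
    (- + 1) ℤ.^ length (primeDivisors (p * d))       ≡⟨ cong ((- + 1) ℤ.^_) (↭ₚ.↭-length primeDivisors-prime-*) ⟩
    (- + 1) ℤ.* (- + 1) ℤ.^ length (primeDivisors d) ≡⟨ ℤₚ.-1*i≡-i _ ⟩
    - ((- + 1) ℤ.^ length (primeDivisors d))         ≡⟨ cong -_ (μ-squareFree sf) ⟨
    - μ d                                            ∎
    where open ≡-Reasoning

prime-divisor : ∀ n → 2 ≤ n → ∃[ p ] Prime p × p ∣ n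
prime-divisor n@(suc _) 2≤n with factorise n
... | record { factors = [] ; isFactorisation = n≡1 } = contradiction n≡1 (ℕₚ.>⇒≢ 2≤n)
... | record { factors = p ∷ ps ; isFactorisation = n≡ ; factorsPrime = p-prime ∷ _ } =
  p , p-prime , subst (p ∣_) (sym n≡) (m∣m*n (product ps))

-- The multiples of p among the divisors of n = p n′ are the p e with e ∣ n′; those with p ∣ e
-- contribute 0, and the others cancel the divisors prime to p.
∑-μ-divisors : ∀ n → 2 ≤ n → ∑ μ (divisors n) ≡ + 0
∑-μ-divisors n@(suc _) 2≤n with prime-divisor n 2≤n
... | p , p-prime , p∣n@(divides n′ n≡) = begin
  ∑ μ (divisors n)                                              ≡⟨ ∑-split (p ∣?_) μ (divisors n) ⟩
  ∑ μ multiples ℤ.+ ∑ μ (filter (¬? ∘ (p ∣?_)) (divisors n))    ≡⟨ cong₂ ℤ._+_ multiples-sum (∑-↭ μ rest-↭) ⟩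
  - ∑ μ rest ℤ.+ ∑ μ rest                                       ≡⟨ ℤₚ.+-inverseˡ (∑ μ rest) ⟩
  + 0                                                           ∎
  where
  open ≡-Reasoning
  multiples = filter (p ∣?_) (divisors n)
  rest      = filter (¬? ∘ (p ∣?_)) (divisors n′)
  instance
    p≢0 : NonZero p
    p≢0 = prime⇒nonZero p-prime
    n′≢0 : NonZero n′
    n′≢0 = ∣⇒nonZero (divides p (trans n≡ (ℕₚ.*-comm n′ p)))
  n≡pn′ : n ≡ p * n′
  n≡pn′ = trans n≡ (ℕₚ.*-comm n′ p)
  n′∣n : n′ ∣ n
  n′∣n = divides p n≡pn′

  multiples-↭ : multiples ↭ map (p *_) (divisors n′)
  multiples-↭ = unique-↭ (Unique.filter⁺ (p ∣?_) (divisors-Unique n))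
    (Unique.map⁺ (ℕₚ.*-cancelˡ-≡ _ _ p) (divisors-Unique n′)) to from
    where
    to : ∀ {e} → e ∈ multiples → e ∈ map (p *_) (divisors n′)
    to e∈ with ∈-filter⁻ (p ∣?_) {xs = divisors n} e∈
    ... | e∈n , divides e′ refl = subst (_∈ map (p *_) (divisors n′)) (ℕₚ.*-comm p e′)
      (∈-map⁺ (p *_) (∈-divisors⁺ (*-cancelʳ-∣ p (subst (e′ * p ∣_) n≡ (∈-divisors⁻ {n = n} e∈n)))))
    from : ∀ {e} → e ∈ map (p *_) (divisors n′) → e ∈ multiples
    from e∈ with ∈-map⁻ (p *_) e∈
    ... | e′ , e′∈ , refl = ∈-filter⁺ (p ∣?_)
      (∈-divisors⁺ (subst (p * e′ ∣_) (sym n≡pn′) (*-monoʳ-∣ p (∈-divisors⁻ {n = n′} e′∈)))) (m∣m*n e′)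

  rest-↭ : filter (¬? ∘ (p ∣?_)) (divisors n) ↭ rest
  rest-↭ = unique-↭ (Unique.filter⁺ (¬? ∘ (p ∣?_)) (divisors-Unique n))
    (Unique.filter⁺ (¬? ∘ (p ∣?_)) (divisors-Unique n′)) to from
    where
    to : ∀ {e} → e ∈ filter (¬? ∘ (p ∣?_)) (divisors n) → e ∈ rest
    to {e} e∈ with ∈-filter⁻ (¬? ∘ (p ∣?_)) {xs = divisors n} e∈
    ... | e∈n , p∤e = ∈-filter⁺ (¬? ∘ (p ∣?_))
      (∈-divisors⁺ (coprime-divisor coprime (subst (e ∣_) n≡pn′ (∈-divisors⁻ {n = n} e∈n)))) p∤e
      where
      coprime : ∀ {i} → i ∣ e × i ∣ p → i ≡ 1
      coprime (i∣e , i∣p) with prime⇒irreducible p-prime i∣p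
      ... | inj₁ i≡1 = i≡1
      ... | inj₂ refl = contradiction i∣e p∤e
    from : ∀ {e} → e ∈ rest → e ∈ filter (¬? ∘ (p ∣?_)) (divisors n)
    from e∈ with ∈-filter⁻ (¬? ∘ (p ∣?_)) {xs = divisors n′} e∈
    ... | e∈n′ , p∤e = ∈-filter⁺ (¬? ∘ (p ∣?_)) (∈-divisors⁺ (∣-trans (∈-divisors⁻ {n = n′} e∈n′) n′∣n)) p∤e

  p-part : ∀ {e} → e ∈ filter (p ∣?_) (divisors n′) → μ (p * e) ≡ + 0
  p-part {e} e∈ with ∈-filter⁻ (p ∣?_) {xs = divisors n′} e∈
  ... | e∈n′ , p∣e = μ-square {{ℕₚ.m*n≢0 p e {{p≢0}} {{∣⇒nonZero (∈-divisors⁻ {n = n′} e∈n′)}}}}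
    (ℕ.nonTrivial⇒n>1 p {{prime⇒nonTrivial p-prime}}) (*-monoʳ-∣ p p∣e)

  p′-part : ∀ {e} → e ∈ rest → μ (p * e) ≡ - μ e
  p′-part e∈ with ∈-filter⁻ (¬? ∘ (p ∣?_)) {xs = divisors n′} e∈
  ... | e∈n′ , p∤e = μ-prime-* p-prime p∤e {{∣⇒nonZero (∈-divisors⁻ {n = n′} e∈n′)}}

  multiples-sum : ∑ μ multiples ≡ - ∑ μ rest
  multiples-sum = begin
    ∑ μ multiples                         ≡⟨ ∑-↭ μ multiples-↭ ⟩
    ∑ μ (map (p *_) (divisors n′))        ≡⟨ ∑-map μ (p *_) (divisors n′) ⟩
    ∑ (μ ∘ (p *_)) (divisors n′)          ≡⟨ ∑-split (p ∣?_) (μ ∘ (p *_)) (divisors n′) ⟩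
    ∑ (μ ∘ (p *_)) (filter (p ∣?_) (divisors n′)) ℤ.+ ∑ (μ ∘ (p *_)) rest
      ≡⟨ cong₂ ℤ._+_ (trans (∑-cong-∈ (filter (p ∣?_) (divisors n′)) p-part) (∑-0 (filter (p ∣?_) (divisors n′))))
                     (∑-cong-∈ rest p′-part) ⟩
    + 0 ℤ.+ ∑ (-_ ∘ μ) rest               ≡⟨ ℤₚ.+-identityˡ _ ⟩
    ∑ (-_ ∘ μ) rest                       ≡⟨ ∑-neg μ rest ⟩
    - ∑ μ rest                            ∎

𝟙-cong : {P Q : Set} (P? : Dec P) (Q? : Dec Q) → (P → Q) → (Q → P) → 𝟙 P? ≡ 𝟙 Q?
𝟙-cong (yes _) (yes _) f g = refl
𝟙-cong (yes p) (no ¬q) f g = contradiction (f p) ¬q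
𝟙-cong (no ¬p) (yes q) f g = contradiction (g q) ¬p
𝟙-cong (no _)  (no _)  f g = refl

*-div : ∀ d .{{_ : NonZero d}} e → (d * e) div d ≡ e
*-div d@(suc _) e = trans (cong (_/ d) (ℕₚ.*-comm d e)) (m*n/n≡m e d)

intermediate : ℕ → ℕ → List ℕ
intermediate d m = filter (λ k → d ∣? k ×-dec k ∣? m) (range1 m)

∈-intermediate⁻ : ∀ {d m k} → k ∈ intermediate d m → d ∣ k × k ∣ m
∈-intermediate⁻ {d} {m} k∈ = proj₂ (∈-filter⁻ (λ k → d ∣? k ×-dec k ∣? m) {xs = range1 m} k∈)

-- Möbius inversion in the form used for counting, with s the number of symmetries of a word. If d ∤
-- s, no k satisfies d ∣ k ∣ s. If s = d t, substituting k = d e turns the sum into that of μ over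
-- the divisors of t, which vanishes unless t = 1.
∑-μ-intermediate : ∀ {d s m} .{{_ : NonZero d}} .{{_ : NonZero m}} → s ∣ m →
                   ∑ (λ k → 𝟙 (k ∣? s) ℤ.* μ (k div d)) (intermediate d m) ≡ 𝟙 (s ℕ.≟ d)
∑-μ-intermediate {d} {s} {m} s∣m = trans (sym (∑-filter (_∣? s) f (intermediate d m))) (main (d ∣? s))
  where
  open ≡-Reasoning
  f = λ k → μ (k div d)
  ks = filter (_∣? s) (intermediate d m)
  Q? = λ k → d ∣? k ×-dec k ∣? m

  ∈-ks⁻ : ∀ {k} → k ∈ ks → d ∣ k × k ∣ s
  ∈-ks⁻ k∈ with ∈-filter⁻ (_∣? s) {xs = intermediate d m} k∈
  ... | k∈′ , k∣s = proj₁ (∈-intermediate⁻ {d} {m} k∈′) , k∣s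

  module _ {t} (s≡dt : s ≡ d * t) where
    instance
      dt≢0 : NonZero (d * t)
      dt≢0 = subst NonZero s≡dt (∣⇒nonZero s∣m)
      t≢0 : NonZero t
      t≢0 = ∣⇒nonZero (n∣m*n d)

    ks-↭ : ks ↭ map (d *_) (divisors t)
    ks-↭ = unique-↭ (Unique.filter⁺ (_∣? s) (Unique.filter⁺ Q? (range1-Unique m)))
                    (Unique.map⁺ (ℕₚ.*-cancelˡ-≡ _ _ d) (divisors-Unique t)) to from
      where
      to : ∀ {k} → k ∈ ks → k ∈ map (d *_) (divisors t)
      to k∈ with ∈-ks⁻ k∈
      ... | divides e refl , k∣s = subst (_∈ map (d *_) (divisors t)) (ℕₚ.*-comm d e)
        (∈-map⁺ (d *_) (∈-divisors⁺ {n = t} (*-cancelʳ-∣ d (subst (e * d ∣_) (trans s≡dt (ℕₚ.*-comm d t)) k∣s))))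
      from : ∀ {k} → k ∈ map (d *_) (divisors t) → k ∈ ks
      from k∈ with ∈-map⁻ (d *_) k∈
      ... | e , e∈ , refl = ∈-filter⁺ (_∣? s)
        (∈-filter⁺ Q? (∈-range1⁺ {{∣⇒nonZero de∣m}} (∣⇒≤ de∣m)) (m∣m*n e , de∣m)) de∣s
        where
        de∣s : d * e ∣ s
        de∣s = subst (d * e ∣_) (sym s≡dt) (*-monoʳ-∣ d (∈-divisors⁻ {n = t} e∈))
        de∣m = ∣-trans de∣s s∣m

    ks-sum : ∑ f ks ≡ ∑ μ (divisors t)
    ks-sum = begin
      ∑ f ks                         ≡⟨ ∑-↭ f ks-↭ ⟩
      ∑ f (map (d *_) (divisors t))  ≡⟨ ∑-map f (d *_) (divisors t) ⟩
      ∑ (f ∘ (d *_)) (divisors t)    ≡⟨ ∑-cong-∈ (divisors t) (λ {e} _ → cong μ (*-div d e)) ⟩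
      ∑ μ (divisors t)               ∎

  main : Dec (d ∣ s) → ∑ f ks ≡ 𝟙 (s ℕ.≟ d)
  main (no d∤s) with ks | (λ {k} → ∈-ks⁻ {k}) | s ℕ.≟ d
  ... | _     | _  | yes refl = contradiction ∣-refl d∤s
  ... | []    | _  | no _ = refl
  ... | k ∷ _ | h  | no _ = contradiction (∣-trans (proj₁ (h (here refl))) (proj₂ (h (here refl)))) d∤s
  main (yes (divides t s≡td)) with s ℕ.≟ d
  -- Here t is taken to be 1, and `∑ μ (divisors 1)` evaluates to 1.
  ... | yes s≡d = trans (ks-sum {1} (trans s≡d (sym (ℕₚ.*-identityʳ d)))) refl
  ... | no  s≢d = trans (ks-sum s≡dt) (∑-μ-divisors t 2≤t)
    where
    s≡dt = trans s≡td (ℕₚ.*-comm t d)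
    t≢1 : t ≢ 1
    t≢1 refl = s≢d (trans s≡td (ℕₚ.*-identityˡ d))
    2≤t : 2 ≤ t
    2≤t = ℕₚ.≤∧≢⇒< (ℕ.>-nonZero⁻¹ t {{t≢0 s≡dt}}) (t≢1 ∘ sym)

-- Periods of iterated maps and counting of orbits

iter-+ : {A : Set} (f : A → A) (i j : ℕ) (x : A) → iter f (i + j) x ≡ iter f i (iter f j x)
iter-+ f zero    j x = refl
iter-+ f (suc i) j x = cong f (iter-+ f i j x)

iter-∘ : {A : Set} (f : A → A) (i j : ℕ) (x : A) → iter f i (iter f j x) ≡ iter f j (iter f i x)
iter-∘ f i j x = trans (sym (iter-+ f i j x)) (trans (cong (λ k → iter f k x) (ℕₚ.+-comm i j)) (iter-+ f j i x))

iter-iter : {A : Set} (f : A → A) (i j : ℕ) (x : A) → iter (iter f j) i x ≡ iter f (i * j) x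
iter-iter f zero    j x = refl
iter-iter f (suc i) j x = trans (cong (iter f j) (iter-iter f i j x)) (sym (iter-+ f j (i * j) x))

iter-fixed : {A : Set} (f : A → A) (i : ℕ) {x : A} → f x ≡ x → iter f i x ≡ x
iter-fixed f zero    e = refl
iter-fixed f (suc i) e = trans (cong f (iter-fixed f i e)) e

iter-∣ : {A : Set} (f : A → A) {i j : ℕ} {x : A} → i ∣ j → iter f i x ≡ x → iter f j x ≡ x
iter-∣ f {i} {x = x} (divides t refl) e = trans (sym (iter-iter f t i x)) (iter-fixed (iter f i) t e)

iter-return : {A : Set} (f : A → A) {i p : ℕ} {x : A} → i ≤ p → iter f p x ≡ x → iter f (p ∸ i) (iter f i x) ≡ x
iter-return f {i} {p} {x} i≤p e = trans (sym (iter-+ f (p ∸ i) i x)) (trans (cong (λ k → iter f k x) (ℕₚ.m∸n+n≡m i≤p)) e)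

record Period {A : Set} (f : A → A) (x : A) (p : ℕ) : Set where
  field
    positive : 0 < p
    returns  : iter f p x ≡ x
    minimal  : ∀ j → 0 < j → j < p → iter f j x ≢ x

  instance
    nonZero : NonZero p
    nonZero = ℕ.>-nonZero positive

open Period

module _ {A : Set} {f : A → A} {x : A} where

  iter-% : ∀ {p} (P : Period f x p) j → iter f ((j % p) {{nonZero P}}) x ≡ iter f j x
  iter-% {p} P j = begin
    iter f (j % p) x                     ≡⟨ cong (iter f (j % p)) (iter-∣ f (n∣m*n (j / p)) (returns P)) ⟨
    iter f (j % p) (iter f (j / p * p) x) ≡⟨ iter-+ f (j % p) (j / p * p) x ⟨
    iter f (j % p + j / p * p) x          ≡⟨ cong (λ k → iter f k x) (m≡m%n+[m/n]*n j p) ⟨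
    iter f j x                            ∎
    where
    open ≡-Reasoning
    instance _ = nonZero P

  -- The remainder of j modulo p is again a return time, and it lies below the least positive one.
  period-∣ : ∀ {p j} → Period f x p → iter f j x ≡ x → p ∣ j
  period-∣ {p} {j} P e with (j % p) {{nonZero P}} in eq
  ... | zero  = m%n≡0⇒n∣m j p {{nonZero P}} eq
  ... | suc r = contradiction (trans (trans (cong (λ k → iter f k x) (sym eq)) (iter-% P j)) e)
                  (minimal P (suc r) (s≤s z≤n) (subst (_< p) eq (m%n<n j p {{nonZero P}})))

  period-unique : ∀ {p q} → Period f x p → Period f x q → p ≡ q
  period-unique P Q = ∣-antisym (period-∣ P (returns Q)) (period-∣ Q (returns P))

  period-injective : ∀ {p i j} → Period f x p → i ≤ j → j < p → iter f i x ≡ iter f j x → i ≡ j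
  period-injective {p} {i} {j} P i≤j j<p e = ℕₚ.≤-antisym i≤j (ℕₚ.m∸n≡0⇒m≤n j∸i≡0)
    where
    instance _ = nonZero P
    i≤p = ℕₚ.≤-trans i≤j (ℕₚ.<⇒≤ j<p)
    back : iter f (p ∸ i + j) x ≡ x
    back = trans (iter-+ f (p ∸ i) j x) (trans (cong (iter f (p ∸ i)) (sym e)) (iter-return f i≤p (returns P)))
    shape : p ∸ i + j ≡ p + (j ∸ i)
    shape = trans (sym (ℕₚ.+-∸-comm j i≤p)) (ℕₚ.+-∸-assoc p i≤j)
    p∣j∸i : p ∣ j ∸ i
    p∣j∸i = ∣m+n∣m⇒∣n (subst (p ∣_) shape (period-∣ P back)) ∣-refl
    j∸i≡0 : j ∸ i ≡ 0
    j∸i≡0 with j ∸ i | p∣j∸i | ℕₚ.≤-<-trans (ℕₚ.m∸n≤m j i) j<p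
    ... | zero  | _   | _   = refl
    ... | suc _ | p∣k | k<p = contradiction (∣⇒≤ p∣k) (ℕₚ.<⇒≱ k<p)

  private
    least : DecidableEquality A → ∀ m → (∃[ p ] p ≤ m × Period f x p) ⊎ (∀ j → 0 < j → j ≤ m → iter f j x ≢ x)
    least _≟_ zero    = inj₂ λ j 0<j j≤0 → contradiction 0<j (ℕₚ.≤⇒≯ j≤0)
    least _≟_ (suc m) with least _≟_ m
    ... | inj₁ (p , p≤m , P) = inj₁ (p , ℕₚ.m≤n⇒m≤1+n p≤m , P)
    ... | inj₂ none with iter f (suc m) x ≟ x
    ...   | yes e = inj₁ (suc m , ℕₚ.≤-refl , record
      { positive = s≤s z≤n ; returns = e ; minimal = λ j 0<j j<1+m → none j 0<j (ℕₚ.≤-pred j<1+m) })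
    ...   | no ¬e = inj₂ λ j 0<j j≤1+m e → case (ℕₚ.m≤n⇒m<n∨m≡n j≤1+m) 0<j e
      where
      case : ∀ {j} → (j < suc m) ⊎ (j ≡ suc m) → 0 < j → iter f j x ≢ x
      case (inj₁ j<1+m)  0<j = none _ 0<j (ℕₚ.≤-pred j<1+m)
      case (inj₂ refl) 0<j = ¬e

  -- Sealed: only the property `Period` of the number found is used later, never the search.
  abstract
    period : DecidableEquality A → ∀ m .{{_ : NonZero m}} → iter f m x ≡ x → ∃ (Period f x)
    period _≟_ m e with least _≟_ m
    ... | inj₁ (p , _ , P) = p , P
    ... | inj₂ none        = contradiction e (none m (ℕ.>-nonZero⁻¹ m) ℕₚ.≤-refl)

length-concatMap : {A B : Set} (f : A → List B) {q : ℕ} → (∀ x → length (f x) ≡ q) →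
                   ∀ xs → length (concatMap f xs) ≡ length xs * q
length-concatMap f h []       = refl
length-concatMap f h (x ∷ xs) = trans (length-++ (f x)) (cong₂ _+_ (h x) (length-concatMap f h xs))

-- Greedy choice: an element is kept only if no representative already chosen is related to it.
representatives : {A : Set} {_~_ : A → A → Set} → Reflexive _~_ → Symmetric _~_ → Binary.Decidable _~_ → {P : A → Set} →
  (xs : List A) → All P xs → ∃[ ys ] All P ys × AllPairs (λ x y → ¬ x ~ y) ys × All (λ x → Any (_~ x) ys) xs
representatives ~-refl ~-sym _~?_ []       []         = [] , [] , [] , []
representatives {_~_ = _~_} ~-refl ~-sym _~?_ (x ∷ xs) (px ∷ pxs)
  with representatives {_~_ = _~_} ~-refl ~-sym _~?_ xs pxs
... | ys , pys , apart , covers with Any.any? (_~? x) ys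
...   | yes covered = ys , pys , apart , covered ∷ covers
...   | no  ¬covered = x ∷ ys , px ∷ pys , All.map (_∘ ~-sym) (Allₚ.¬Any⇒All¬ ys ¬covered) ∷ apart
                     , here ~-refl ∷ All.map there covers

-- Orbits of a map of finite order.

module Orbits {N m : ℕ} .{{_ : NonZero m}} (T : Fin N → Fin N) (T^m : ∀ x → iter T m x ≡ x) where

  _~_ : Fin N → Fin N → Set
  x ~ y = ∃[ i ] iter T i x ≡ y

  ~-refl : Reflexive _~_
  ~-refl = 0 , refl

  ~-trans : Transitive _~_
  ~-trans {x} (i , refl) (j , refl) = j + i , iter-+ T j i x

  iter-%m : ∀ i x → iter T (i % m) x ≡ iter T i x
  iter-%m i x = begin
    iter T (i % m) x                      ≡⟨ cong (iter T (i % m)) (iter-∣ T (n∣m*n (i / m)) (T^m x)) ⟨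
    iter T (i % m) (iter T (i / m * m) x) ≡⟨ iter-+ T (i % m) (i / m * m) x ⟨
    iter T (i % m + i / m * m) x          ≡⟨ cong (λ k → iter T k x) (m≡m%n+[m/n]*n i m) ⟨
    iter T i x                            ∎
    where open ≡-Reasoning

  -- Since T^m is the identity, i forward steps are undone by completing the turn. For the same
  -- reason `_~?_` need only test exponents below m.
  ~-sym : Symmetric _~_
  ~-sym {x} (i , refl) = m ∸ i % m , (begin
    iter T (m ∸ i % m) (iter T i x)        ≡⟨ cong (iter T (m ∸ i % m)) (iter-%m i x) ⟨
    iter T (m ∸ i % m) (iter T (i % m) x)  ≡⟨ iter-return T (m%n≤n i m) (T^m x) ⟩
    x                                      ∎)
    where open ≡-Reasoning

  _~?_ : Binary.Decidable _~_
  x ~? y = map′ (λ (i , e) → toℕ i , e)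
    (λ (i , e) → fromℕ< (m%n<n i m) , trans (cong (λ k → iter T k x) (Finₚ.toℕ-fromℕ< (m%n<n i m))) (trans (iter-%m i x) e))
    (Finₚ.any? {n = m} (λ i → iter T (toℕ i) x Finₚ.≟ y))

  -- Some power of T undoes T^i and commutes with T^j, so a return of `iter T i x` is already a
  -- return of x.
  period-iter : ∀ {x p} → Period T x p → ∀ i → Period T (iter T i x) p
  period-iter {x} {p} P i = record
    { positive = positive P
    ; returns  = trans (iter-∘ T p i x) (cong (iter T i) (returns P))
    ; minimal  = λ j 0<j j<p e → minimal P j 0<j j<p (back j e)
    }
    where
    back : ∀ j → iter T j (iter T i x) ≡ iter T i x → iter T j x ≡ x
    back j e with ~-sym {x} (i , refl)
    ... | k , r = begin
      iter T j x                       ≡⟨ cong (iter T j) r ⟨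
      iter T j (iter T k (iter T i x)) ≡⟨ iter-∘ T j k _ ⟩
      iter T k (iter T j (iter T i x)) ≡⟨ cong (iter T k) e ⟩
      iter T k (iter T i x)            ≡⟨ r ⟩
      x                                ∎
      where open ≡-Reasoning

  period~ : ∀ {x y p} → x ~ y → Period T x p → Period T y p
  period~ (i , refl) P = period-iter P i

  per : Fin N → ℕ
  per x = proj₁ (period Finₚ._≟_ m (T^m x))

  per-Period : ∀ x → Period T x (per x)
  per-Period x = proj₂ (period Finₚ._≟_ m (T^m x))

  per-∣ : ∀ x → per x ∣ m
  per-∣ x = period-∣ (per-Period x) (T^m x)

  withPeriod : ℕ → List (Fin N)
  withPeriod q = filter (λ x → per x ℕ.≟ q) (allFin N)

  ∈-withPeriod⁺ : ∀ {q x} → Period T x q → x ∈ withPeriod q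
  ∈-withPeriod⁺ {q} {x} P = ∈-filter⁺ (λ x → per x ℕ.≟ q) (∈-allFin x) (period-unique (per-Period x) P)

  ∈-withPeriod⁻ : ∀ {q x} → x ∈ withPeriod q → Period T x q
  ∈-withPeriod⁻ {q} {x} x∈ with ∈-filter⁻ (λ x → per x ℕ.≟ q) {xs = allFin N} x∈
  ... | _ , refl = per-Period x

  record IsTransversal (q : ℕ) (L : List (Fin N)) : Set where
    field
      periods  : All (λ x → Period T x q) L
      apart    : AllPairs (λ x y → ¬ x ~ y) L
      covering : ∀ x → Period T x q → Any (_~ x) L

  transversal : ∀ q → ∃ (IsTransversal q)
  transversal q with representatives {_~_ = _~_} ~-refl ~-sym _~?_ (withPeriod q) (All.tabulate ∈-withPeriod⁻)
  ... | L , periods , apart , covers = L , record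
    { periods = periods ; apart = apart ; covering = λ x P → All.lookup covers (∈-withPeriod⁺ P) }

  module _ {q L} (isTransversal : IsTransversal q L) where
    open IsTransversal isTransversal

    private
      orbit : Fin N → List (Fin N)
      orbit x = map (λ i → iter T i x) (upTo q)

      ∈-orbit⁻ : ∀ {x y} → y ∈ orbit x → x ~ y
      ∈-orbit⁻ {x} y∈ with ∈-map⁻ (λ i → iter T i x) y∈
      ... | i , _ , refl = i , refl

      ∈-orbit⁺ : ∀ {x y} → Period T x q → x ~ y → y ∈ orbit x
      ∈-orbit⁺ {x} P (i , refl) = subst (_∈ orbit x) (iter-% P i)
        (∈-map⁺ (λ i → iter T i x) (∈-upTo⁺ (m%n<n i q {{nonZero P}})))

      orbit-Unique : ∀ {x} → Period T x q → Unique (orbit x)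
      orbit-Unique {x} P = AllPairsₚ.map⁺ (AllPairsₚ.applyUpTo⁺₁ (λ i → i) q
        (λ i<j j<q e → ℕₚ.<⇒≢ i<j (period-injective P (ℕₚ.<⇒≤ i<j) j<q e)))

      orbits-Unique : Unique (concatMap orbit L)
      orbits-Unique = Unique.concat⁺ (Allₚ.map⁺ (All.map orbit-Unique periods))
        (AllPairsₚ.map⁺ (AllPairs.map (λ x≁y {_} (z∈x , z∈y) → x≁y (~-trans (∈-orbit⁻ z∈x) (~-sym (∈-orbit⁻ z∈y)))) apart))

      to : ∀ {y} → y ∈ concatMap orbit L → y ∈ withPeriod q
      to y∈ = All.lookupWith (λ { P y∈x → ∈-withPeriod⁺ (period~ (∈-orbit⁻ y∈x) P) }) periods (∈-concatMap⁻ orbit y∈)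

      from : ∀ {y} → y ∈ withPeriod q → y ∈ concatMap orbit L
      from {y} y∈ = ∈-concatMap⁺ orbit (orbits periods (covering y (∈-withPeriod⁻ y∈)))
        where
        orbits : ∀ {L} → All (λ x → Period T x q) L → Any (_~ y) L → Any (λ x → y ∈ orbit x) L
        orbits (P ∷ _)  (here x~y) = here (∈-orbit⁺ P x~y)
        orbits (_ ∷ Ps) (there a)  = there (orbits Ps a)

    -- The iterates of a member with exponents below q are distinct and exhaust its orbit. The
    -- orbits of different members are disjoint, and by `covering` their union is the set of all
    -- points of period q.
    transversal-length : length L * q ≡ length (withPeriod q)
    transversal-length = trans
      (sym (length-concatMap orbit (λ x → trans (length-map _ (upTo q)) (length-upTo q)) L))
      (↭ₚ.↭-length (unique-↭ orbits-Unique (Unique.filter⁺ (λ x → per x ℕ.≟ q) (Unique.allFin⁺ N)) to from))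

  fixedBy : ℕ → List (Fin N)
  fixedBy i = filter (λ x → iter T i x Finₚ.≟ x) (allFin N)

  -- With `order x` = m / `per x`, having period q means having order d. `∑-μ-intermediate` expands
  -- this indicator, and after exchanging the sums each k counts the x with k ∣ `order x`. That
  -- condition says `per x` ∣ m / k, that is, T^(m / k) fixes x.
  count-withPeriod : ∀ {q d} → m ≡ q * d →
    + length (withPeriod q) ≡ ∑ (λ k → μ (k div d) ℤ.* + length (fixedBy (m div k))) (intermediate d m)
  count-withPeriod {q} {d} m≡qd = begin
    + length (withPeriod q)
      ≡⟨ ∑-𝟙 (λ x → per x ℕ.≟ q) (allFin N) ⟨
    ∑ (λ x → 𝟙 (per x ℕ.≟ q)) (allFin N)
      ≡⟨ ∑-cong-∈ (allFin N) (λ {x} _ → trans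
             (𝟙-cong (per x ℕ.≟ q) (order x ℕ.≟ d) (per⇒order x) (order⇒per x))
             (sym (∑-μ-intermediate (order-∣ x)))) ⟩
    ∑ (λ x → ∑ (λ k → 𝟙 (k ∣? order x) ℤ.* μ (k div d)) (intermediate d m)) (allFin N)
      ≡⟨ ∑-exchange (λ x k → 𝟙 (k ∣? order x) ℤ.* μ (k div d)) (allFin N) (intermediate d m) ⟩
    ∑ (λ k → ∑ (λ x → 𝟙 (k ∣? order x) ℤ.* μ (k div d)) (allFin N)) (intermediate d m)
      ≡⟨ ∑-cong-∈ (intermediate d m) inner ⟩
    ∑ (λ k → μ (k div d) ℤ.* + length (fixedBy (m div k))) (intermediate d m) ∎
    where
    open ≡-Reasoning
    order : Fin N → ℕ
    order x = quotient (per-∣ x)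
    m≡order : ∀ x → m ≡ order x * per x
    m≡order x = m∣n⇒n≡quotient*m (per-∣ x)
    order-∣ : ∀ x → order x ∣ m
    order-∣ x = divides (per x) (trans (m≡order x) (ℕₚ.*-comm (order x) (per x)))
    instance
      d≢0 : NonZero d
      d≢0 = ∣⇒nonZero (divides q m≡qd)
    q≢0 : NonZero q
    q≢0 = ∣⇒nonZero (divides d (trans m≡qd (ℕₚ.*-comm q d)))
    per⇒order : ∀ x → per x ≡ q → order x ≡ d
    per⇒order x e = ℕₚ.*-cancelʳ-≡ (order x) d q {{q≢0}} (begin
      order x * q      ≡⟨ cong (order x *_) e ⟨
      order x * per x  ≡⟨ m≡order x ⟨
      m                ≡⟨ m≡qd ⟩
      q * d            ≡⟨ ℕₚ.*-comm q d ⟩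
      d * q            ∎)
    order⇒per : ∀ x → order x ≡ d → per x ≡ q
    order⇒per x e = ℕₚ.*-cancelˡ-≡ (per x) q d (begin
      d * per x        ≡⟨ cong (_* per x) e ⟨
      order x * per x  ≡⟨ m≡order x ⟨
      m                ≡⟨ m≡qd ⟩
      q * d            ≡⟨ ℕₚ.*-comm q d ⟩
      d * q            ∎)
    inner : ∀ {k} → k ∈ intermediate d m →
            ∑ (λ x → 𝟙 (k ∣? order x) ℤ.* μ (k div d)) (allFin N) ≡ μ (k div d) ℤ.* + length (fixedBy (m div k))
    inner {k} k∈ with ∈-intermediate⁻ {d} {m} k∈
    ... | _ , divides l m≡lk = begin
      ∑ (λ x → 𝟙 (k ∣? order x) ℤ.* μ (k div d)) (allFin N)
        ≡⟨ ∑-cong-∈ (allFin N) (λ {x} _ → trans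
             (cong (ℤ._* μ (k div d)) (𝟙-cong (k ∣? order x) (iter T (m div k) x Finₚ.≟ x) (order⇒fixed x) (fixed⇒order x)))
             (ℤₚ.*-comm _ (μ (k div d)))) ⟩
      ∑ (λ x → μ (k div d) ℤ.* 𝟙 (iter T (m div k) x Finₚ.≟ x)) (allFin N)
        ≡⟨ ∑-*ˡ (μ (k div d)) (λ x → 𝟙 (iter T (m div k) x Finₚ.≟ x)) (allFin N) ⟩
      μ (k div d) ℤ.* ∑ (λ x → 𝟙 (iter T (m div k) x Finₚ.≟ x)) (allFin N)
        ≡⟨ cong (μ (k div d) ℤ.*_) (∑-𝟙 (λ x → iter T (m div k) x Finₚ.≟ x) (allFin N)) ⟩
      μ (k div d) ℤ.* + length (fixedBy (m div k)) ∎
      where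
      instance
        k≢0 : NonZero k
        k≢0 = ∣⇒nonZero (divides l m≡lk)
      m-div-k : m div k ≡ l
      m-div-k = trans (cong (_div k) (trans m≡lk (ℕₚ.*-comm l k))) (*-div k l)
      order⇒fixed : ∀ x → k ∣ order x → iter T (m div k) x ≡ x
      order⇒fixed x (divides t e) = trans (cong (λ i → iter T i x) m-div-k)
        (iter-∣ T (divides t (ℕₚ.*-cancelʳ-≡ l (t * per x) k (begin
          l * k            ≡⟨ m≡lk ⟨
          m                ≡⟨ m≡order x ⟩
          order x * per x  ≡⟨ cong (_* per x) e ⟩
          t * k * per x    ≡⟨ ℕₚ.*-assoc t k (per x) ⟩
          t * (k * per x)  ≡⟨ cong (t *_) (ℕₚ.*-comm k (per x)) ⟩
          t * (per x * k)  ≡⟨ ℕₚ.*-assoc t (per x) k ⟨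
          t * per x * k    ∎))) (returns (per-Period x)))
      fixed⇒order : ∀ x → iter T (m div k) x ≡ x → k ∣ order x
      fixed⇒order x e with period-∣ {j = l} (per-Period x) (trans (cong (λ i → iter T i x) (sym m-div-k)) e)
      ... | divides t l≡ = divides t (ℕₚ.*-cancelʳ-≡ (order x) (t * k) (per x) {{nonZero (per-Period x)}} (begin
          order x * per x  ≡⟨ m≡order x ⟨
          m                ≡⟨ m≡lk ⟩
          l * k            ≡⟨ cong (_* k) l≡ ⟩
          t * per x * k    ≡⟨ ℕₚ.*-assoc t (per x) k ⟩
          t * (per x * k)  ≡⟨ cong (t *_) (ℕₚ.*-comm (per x) k) ⟩
          t * (k * per x)  ≡⟨ ℕₚ.*-assoc t k (per x) ⟨
          t * k * per x    ∎))

-- Periodic words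

Periodic : {A : Set} → ℕ → (ℕ → A) → Set
Periodic p w = ∀ i → w (p + i) ≡ w i

periodic-* : {A : Set} {p : ℕ} {w : ℕ → A} → Periodic p w → ∀ t → Periodic (t * p) w
periodic-* per zero    i = refl
periodic-* {p = p} {w} per (suc t) i =
  trans (cong w (ℕₚ.+-assoc p (t * p) i)) (trans (per (t * p + i)) (periodic-* {w = w} per t i))

periodic-% : {A : Set} {p : ℕ} {w : ℕ → A} .{{_ : NonZero p}} → Periodic p w → ∀ i → w (i % p) ≡ w i
periodic-% {p = p} {w} per i = begin
  w (i % p)              ≡⟨ periodic-* {w = w} per (i / p) (i % p) ⟨
  w (i / p * p + i % p)  ≡⟨ cong w (ℕₚ.+-comm (i / p * p) (i % p)) ⟩
  w (i % p + i / p * p)  ≡⟨ cong w (m≡m%n+[m/n]*n i p) ⟨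
  w i                    ∎
  where open ≡-Reasoning

funToFin-cong : ∀ {m n} {f g : Fin m → Fin n} → (∀ i → f i ≡ g i) → funToFin f ≡ funToFin g
funToFin-cong {zero}  e = refl
funToFin-cong {suc m} e = cong₂ combine (e zero) (funToFin-cong (e ∘ suc))

-- An element x of Fin (K ^ m) encodes a word of length m over Fin K; at x is its m-periodic extension.
module _ {K m : ℕ} .{{_ : NonZero m}} where

  -- Sealed: outside this block the arithmetic coding is reached only through the laws proved here.
  abstract
    at : Fin (K ^ m) → ℕ → Fin K
    at x i = finToFun x (fromℕ< (m%n<n i m))

    encode : (ℕ → Fin K) → Fin (K ^ m)
    encode w = funToFin {m} (w ∘ toℕ)

    at-encode : ∀ {w} → Periodic m w → ∀ i → at (encode w) i ≡ w i
    at-encode {w} per i = begin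
      at (encode w) i                ≡⟨ Finₚ.finToFun-funToFin {m} (w ∘ toℕ) _ ⟩
      w (toℕ (fromℕ< (m%n<n i m)))   ≡⟨ cong w (Finₚ.toℕ-fromℕ< (m%n<n i m)) ⟩
      w (i % m)                      ≡⟨ periodic-% {w = w} per i ⟩
      w i                            ∎
      where open ≡-Reasoning

    at-periodic : ∀ x → Periodic m (at x)
    at-periodic x i = cong (finToFun {K} {m} x)
      (Finₚ.fromℕ<-cong _ _ (trans (cong (_% m) (ℕₚ.+-comm m i)) ([m+n]%n≡m%n i m)) _ _)

    encode-at : ∀ x → encode (at x) ≡ x
    encode-at x = trans (funToFin-cong λ i → cong (finToFun x) (fixed i)) (Finₚ.funToFin-finToFin {m} x)
      where
      fixed : ∀ i → fromℕ< (m%n<n (toℕ i) m) ≡ i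
      fixed i = Finₚ.toℕ-injective (trans (Finₚ.toℕ-fromℕ< _) (m<n⇒m%n≡m (Finₚ.toℕ<n i)))

    at-injective : ∀ {x y} → (∀ i → at x i ≡ at y i) → x ≡ y
    at-injective {x} {y} e = trans (sym (encode-at x)) (trans (funToFin-cong {m} (e ∘ toℕ)) (encode-at y))

  shift : Fin (K ^ m) → Fin (K ^ m)
  shift x = encode (at x ∘ suc)

  at-shift : ∀ x i → at (shift x) i ≡ at x (suc i)
  at-shift x = at-encode λ i → trans (cong (at x) (sym (ℕₚ.+-suc m i))) (at-periodic x (suc i))

  at-iter-shift : ∀ j x i → at (iter shift j x) i ≡ at x (j + i)
  at-iter-shift zero    x i = refl
  at-iter-shift (suc j) x i = trans (at-shift (iter shift j x) i)
    (trans (at-iter-shift j x (suc i)) (cong (at x) (ℕₚ.+-suc j i)))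

  shift^m : ∀ x → iter shift m x ≡ x
  shift^m x = at-injective λ i → trans (at-iter-shift m x i) (at-periodic x i)

module _ {K m q : ℕ} .{{_ : NonZero m}} .{{_ : NonZero q}} (q∣m : q ∣ m) where
  open Orbits {K ^ m} {m} shift shift^m using (fixedBy)

  private
    at-q-periodic : ∀ (y : Fin (K ^ q)) → Periodic m (at {K} {q} y)
    at-q-periodic y i = trans (cong (λ m → at {K} {q} y (m + i)) (m∣n⇒n≡quotient*m q∣m))
      (periodic-* {w = at {K} {q} y} (at-periodic {K} {q} y) (quotient q∣m) i)

    repeat : Fin (K ^ q) → Fin (K ^ m)
    repeat y = encode (at {K} {q} y)

    at-repeat : ∀ y i → at (repeat y) i ≡ at {K} {q} y i
    at-repeat y = at-encode (at-q-periodic y)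

    repeat-injective : ∀ {x y} → repeat x ≡ repeat y → x ≡ y
    repeat-injective {x} {y} e = at-injective {K} {q} λ i →
      trans (sym (at-repeat x i)) (trans (cong (λ z → at z i) e) (at-repeat y i))

    P? = λ (x : Fin (K ^ m)) → iter shift q x Finₚ.≟ x

    to : ∀ {x} → x ∈ fixedBy q → x ∈ map repeat (allFin (K ^ q))
    to {x} x∈ with ∈-filter⁻ P? {xs = allFin (K ^ m)} x∈
    ... | _ , fixed = subst (_∈ map repeat (allFin (K ^ q)))
      (at-injective λ i → trans (at-repeat (encode (at x)) i) (at-encode {K} {q} q-periodic i))
      (∈-map⁺ repeat (∈-allFin (encode {K} {q} (at x))))
      where
      q-periodic : Periodic q (at x)
      q-periodic i = trans (sym (at-iter-shift q x i)) (cong (λ z → at z i) fixed)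

    from : ∀ {x} → x ∈ map repeat (allFin (K ^ q)) → x ∈ fixedBy q
    from x∈ with ∈-map⁻ repeat x∈
    ... | y , _ , refl = ∈-filter⁺ P? (∈-allFin _) (at-injective λ i → begin
      at (iter shift q (repeat y)) i  ≡⟨ at-iter-shift q (repeat y) i ⟩
      at (repeat y) (q + i)           ≡⟨ at-repeat y (q + i) ⟩
      at {K} {q} y (q + i)            ≡⟨ at-periodic {K} {q} y i ⟩
      at {K} {q} y i                  ≡⟨ at-repeat y i ⟨
      at (repeat y) i                 ∎)
      where open ≡-Reasoning

  -- A word fixed by the q-th shift is a q-periodic sequence, so it is the repetition of a unique
  -- word of length q.
  length-fixedBy : length (fixedBy q) ≡ K ^ q
  length-fixedBy = trans
    (↭ₚ.↭-length (unique-↭ (Unique.filter⁺ P? (Unique.allFin⁺ (K ^ m)))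
      (Unique.map⁺ repeat-injective (Unique.allFin⁺ (K ^ q))) to from))
    (trans (length-map repeat (allFin (K ^ q))) (length-tabulate {n = K ^ q} (λ i → i)))

-- Rotations at a vertex

⟨$⟩ʳ-injective : ∀ {n} (π : Permutation′ n) {x y} → π ⟨$⟩ʳ x ≡ π ⟨$⟩ʳ y → x ≡ y
⟨$⟩ʳ-injective π e = trans (sym (inverseˡ π)) (trans (cong (π ⟨$⟩ˡ_) e) (inverseˡ π))

-- Numbering of all permutations by their Lehmer code: since `suc m !` is `suc m * m !`, an index
-- splits into the image of `zero` and the index of the permutation left after deleting `zero` and
-- its image.
permute : ∀ m → Fin (m !) → Permutation′ m
extend  : ∀ m → Fin (suc m) × Fin (m !) → Permutation′ (suc m)
permute zero    _ = Perm.id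
permute (suc m) k = extend m (remQuot {suc m} (m !) k)
extend m (i , l) = insert zero i (permute m l)

permute-injective : ∀ m {k l : Fin (m !)} → permute m k Perm.≈ permute m l → k ≡ l
extend-injective  : ∀ m {p q : Fin (suc m) × Fin (m !)} → extend m p Perm.≈ extend m q → p ≡ q
permute-injective zero    {zero} {zero} e = refl
permute-injective (suc m) {k} {l} e = begin
  k                                     ≡⟨ Finₚ.combine-remQuot {suc m} (m !) k ⟨
  uncurry combine (remQuot {suc m} (m !) k) ≡⟨ cong (uncurry combine) (extend-injective m e) ⟩
  uncurry combine (remQuot {suc m} (m !) l) ≡⟨ Finₚ.combine-remQuot {suc m} (m !) l ⟩
  l                                     ∎
  where open ≡-Reasoning
extend-injective m {i , k} {j , l} e = cong₂ _,_ (e zero) (permute-injective m λ x → Finₚ.punchIn-injective i _ _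
  (trans (e (suc x)) (cong (λ h → punchIn h (permute m l ⟨$⟩ʳ x)) (sym (e zero)))))

permute-surjective : ∀ m (π : Permutation′ m) → ∃[ k ] permute m k Perm.≈ π
permute-surjective zero    π = zero , λ ()
permute-surjective (suc m) π with permute-surjective m (remove zero π)
... | l , e = combine (π ⟨$⟩ʳ zero) l , λ i → begin
  extend m (remQuot {suc m} (m !) (combine (π ⟨$⟩ʳ zero) l)) ⟨$⟩ʳ i
    ≡⟨ cong (λ p → extend m p ⟨$⟩ʳ i) (Finₚ.remQuot-combine (π ⟨$⟩ʳ zero) l) ⟩
  insert zero (π ⟨$⟩ʳ zero) (permute m l) ⟨$⟩ʳ i
    ≡⟨ insert-cong i ⟩
  insert zero (π ⟨$⟩ʳ zero) (remove zero π) ⟨$⟩ʳ i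
    ≡⟨ Perm.insert-remove zero π i ⟩
  π ⟨$⟩ʳ i ∎
  where
  open ≡-Reasoning
  insert-cong : insert zero (π ⟨$⟩ʳ zero) (permute m l) Perm.≈ insert zero (π ⟨$⟩ʳ zero) (remove zero π)
  insert-cong zero    = refl
  insert-cong (suc j) = cong (punchIn (π ⟨$⟩ʳ zero)) (e j)

-- `IsRotationSystem` at a single vertex, so that conjugates, model cycles and letters can be
-- treated apart from a whole map.
record IsRotation {n : ℕ} (v : Fin n) (f : Fin n → Fin n) : Set where
  field
    fixes        : f v ≡ v
    injective    : ∀ x y → f x ≡ f y → x ≡ y
    single-cycle : ∀ u w → u ≢ v → w ≢ v → ∃[ k ] iter f k u ≡ w

open IsRotation

conjugate : ∀ {n} → Permutation′ n → (Fin n → Fin n) → Fin n → Fin n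
conjugate π f x = π ⟨$⟩ʳ f (π ⟨$⟩ˡ x)

iter-conjugate : ∀ {n} (π : Permutation′ n) (f : Fin n → Fin n) k x →
                 iter (conjugate π f) k (π ⟨$⟩ʳ x) ≡ π ⟨$⟩ʳ iter f k x
iter-conjugate π f zero    x = refl
iter-conjugate π f (suc k) x = trans (cong (conjugate π f) (iter-conjugate π f k x)) (cong (λ y → π ⟨$⟩ʳ f y) (inverseˡ π))

conjugate-isRotation : ∀ {n} (π : Permutation′ n) {v f} → IsRotation v f → IsRotation (π ⟨$⟩ʳ v) (conjugate π f)
conjugate-isRotation π {v} {f} R = record
  { fixes        = trans (cong (λ y → π ⟨$⟩ʳ f y) (inverseˡ π)) (cong (π ⟨$⟩ʳ_) (fixes R))
  ; injective    = λ x y e → ⟨$⟩ʳ-injective (flip π) (injective R _ _ (⟨$⟩ʳ-injective π e))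
  ; single-cycle = λ u w u≢ w≢ → let k , e = single-cycle R (π ⟨$⟩ˡ u) (π ⟨$⟩ˡ w) (off u≢) (off w≢) in
      k , (begin
        iter (conjugate π f) k u                       ≡⟨ cong (iter (conjugate π f) k) (inverseʳ π) ⟨
        iter (conjugate π f) k (π ⟨$⟩ʳ (π ⟨$⟩ˡ u))     ≡⟨ iter-conjugate π f k _ ⟩
        π ⟨$⟩ʳ iter f k (π ⟨$⟩ˡ u)                     ≡⟨ cong (π ⟨$⟩ʳ_) e ⟩
        π ⟨$⟩ʳ (π ⟨$⟩ˡ w)                              ≡⟨ inverseʳ π ⟩
        w                                              ∎)
  }
  where
  open ≡-Reasoning
  off : ∀ {u} → u ≢ π ⟨$⟩ʳ v → π ⟨$⟩ˡ u ≢ v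
  off u≢ e = u≢ (trans (sym (inverseʳ π)) (cong (π ⟨$⟩ʳ_) e))

-- Serves twice: centred at r it labels the vertices of a map relative to u, and centred at label 1
-- with start 0 it reads off the permutation behind a letter.
frame : ∀ {m} → (Fin (suc m) → Fin (suc m)) → Fin (suc m) → Fin (suc m) → Fin (suc m) → Fin (suc m)
frame f v u zero    = v
frame f v u (suc i) = iter f (toℕ i) u

module _ {m : ℕ} {v : Fin (suc (suc m))} {f : Fin (suc (suc m)) → Fin (suc (suc m))} (R : IsRotation v f) where

  iter-injective : ∀ k {x y} → iter f k x ≡ iter f k y → x ≡ y
  iter-injective zero    e = e
  iter-injective (suc k) e = iter-injective k (injective R _ _ e)

  iter-≢ : ∀ k {u} → u ≢ v → iter f k u ≢ v
  iter-≢ zero    u≢v = u≢v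
  iter-≢ (suc k) u≢v e = iter-≢ k u≢v (injective R _ _ (trans e (sym (fixes R))))

  -- The iterates of u avoid v, so among the first `suc (suc m)` of them two coincide, and
  -- cancelling gives a return time of at most `suc m`. Conversely every vertex other than v is
  -- reached, at a time that can be reduced modulo p, which injects `suc m` vertices into p times.
  rotation-period : ∀ {u} → u ≢ v → Period f u (suc m)
  rotation-period {u} u≢v
    with Finₚ.pigeonhole (ℕₚ.n<1+n (suc m)) (λ i → punchOut (iter-≢ (toℕ i) u≢v ∘ sym))
  ... | i , j , i<j , e = subst (Period f u) (ℕₚ.≤-antisym p≤1+m 1+m≤p) P
    where
    δ = toℕ j ∸ toℕ i
    instance
      δ≢0 : NonZero δ
      δ≢0 = ℕ.>-nonZero (ℕₚ.m<n⇒0<n∸m i<j)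
    returns-δ : iter f δ u ≡ u
    returns-δ = iter-injective (toℕ i) (begin
      iter f (toℕ i) (iter f δ u)  ≡⟨ iter-+ f (toℕ i) δ u ⟨
      iter f (toℕ i + δ) u         ≡⟨ cong (λ k → iter f k u) (ℕₚ.m+[n∸m]≡n (ℕₚ.<⇒≤ i<j)) ⟩
      iter f (toℕ j) u             ≡⟨ Finₚ.punchOut-injective (iter-≢ (toℕ i) u≢v ∘ sym) (iter-≢ (toℕ j) u≢v ∘ sym) e ⟨
      iter f (toℕ i) u             ∎)
      where open ≡-Reasoning
    p = proj₁ (period Finₚ._≟_ δ returns-δ)
    P = proj₂ (period Finₚ._≟_ δ returns-δ)
    p≤1+m : p ≤ suc m
    p≤1+m = ℕₚ.≤-trans (∣⇒≤ (period-∣ P returns-δ)) (ℕₚ.≤-trans (ℕₚ.m∸n≤m (toℕ j) (toℕ i)) (ℕₚ.≤-pred (Finₚ.toℕ<n j)))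
    instance _ = Period.nonZero P
    time : ∀ w → ∃[ k ] iter f k u ≡ punchIn v w
    time w = single-cycle R u (punchIn v w) u≢v (Finₚ.punchInᵢ≢i v w)
    time-injective : ∀ {w w′} → fromℕ< (m%n<n (proj₁ (time w)) p) ≡ fromℕ< (m%n<n (proj₁ (time w′)) p) → w ≡ w′
    time-injective {w} {w′} eq = Finₚ.punchIn-injective v w w′ (begin
      punchIn v w                     ≡⟨ proj₂ (time w) ⟨
      iter f (proj₁ (time w)) u       ≡⟨ iter-% P (proj₁ (time w)) ⟨
      iter f (proj₁ (time w) % p) u   ≡⟨ cong (λ k → iter f k u) (Finₚ.fromℕ<-injective _ _ _ _ eq) ⟩
      iter f (proj₁ (time w′) % p) u  ≡⟨ iter-% P (proj₁ (time w′)) ⟩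
      iter f (proj₁ (time w′)) u      ≡⟨ proj₂ (time w′) ⟩
      punchIn v w′                    ∎)
      where open ≡-Reasoning
    1+m≤p : suc m ≤ p
    1+m≤p = Finₚ.injective⇒≤ time-injective

  iter-%-frame : ∀ {u} → u ≢ v → ∀ k → iter f k u ≡ frame f v u (suc (fromℕ< (m%n<n k (suc m))))
  iter-%-frame {u} u≢v k = trans (sym (iter-% (rotation-period u≢v) k))
    (cong (λ i → iter f i u) (sym (Finₚ.toℕ-fromℕ< (m%n<n k (suc m)))))

  frame-injective : ∀ {u} → u ≢ v → ∀ {x y} → frame f v u x ≡ frame f v u y → x ≡ y
  frame-injective u≢v {zero}  {zero}  e = refl
  frame-injective u≢v {zero}  {suc j} e = contradiction (sym e) (iter-≢ (toℕ j) u≢v)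
  frame-injective u≢v {suc i} {zero}  e = contradiction e (iter-≢ (toℕ i) u≢v)
  frame-injective u≢v {suc i} {suc j} e with ℕₚ.≤-total (toℕ i) (toℕ j)
  ... | inj₁ i≤j = cong suc (Finₚ.toℕ-injective (period-injective (rotation-period u≢v) i≤j (Finₚ.toℕ<n j) e))
  ... | inj₂ j≤i = cong suc (Finₚ.toℕ-injective (sym (period-injective (rotation-period u≢v) j≤i (Finₚ.toℕ<n i) (sym e))))

  abstract
    frame-surjective : ∀ {u} → u ≢ v → ∀ w → ∃[ x ] frame f v u x ≡ w
    frame-surjective {u} u≢v w with w Finₚ.≟ v
    ... | yes w≡v = zero , sym w≡v
    ... | no  w≢v with single-cycle R u w u≢v w≢v
    ...   | k , e = suc (fromℕ< (m%n<n k (suc m))) , trans (sym (iter-%-frame u≢v k)) e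

  framing : ∀ {u} → u ≢ v → Permutation′ (suc (suc m))
  framing {u} u≢v = permutation (frame f v u) (proj₁ ∘ frame-surjective u≢v) (proj₂ ∘ frame-surjective u≢v)
    (λ x → frame-injective u≢v (proj₂ (frame-surjective u≢v (frame f v u x))))

  -- Every vertex other than v is an iterate of u, so the sequence starting at u determines the
  -- whole rotation.
  rotation-unique : ∀ {g} → IsRotation v g → ∀ {u} → u ≢ v → (∀ k → iter f k u ≡ iter g k u) → f ≗ g
  rotation-unique {g} S {u} u≢v e w with w Finₚ.≟ v
  ... | yes refl = trans (fixes R) (sym (fixes S))
  ... | no  w≢v with single-cycle R u w u≢v w≢v
  ...   | k , refl = trans (e (suc k)) (cong g (sym (e k)))

-- The model cycle 1, 2, ..., 1 + m with 0 fixed. Its conjugates provide both the letters and the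
-- rotation at r of the realized maps.
standard : ∀ {m} → Fin (suc (suc m)) → Fin (suc (suc m))
standard     zero    = zero
standard {m} (suc i) = suc (fromℕ< (m%n<n (suc (toℕ i)) (suc m)))

module _ {m : ℕ} where

  iter-standard : ∀ k → iter standard k (suc zero) ≡ suc (fromℕ< (m%n<n k (suc m)))
  iter-standard zero    = refl
  iter-standard (suc k) = trans (cong standard (iter-standard k)) (cong suc (Finₚ.fromℕ<-cong _ _ (begin
    suc (toℕ (fromℕ< (m%n<n k (suc m)))) % suc m  ≡⟨ cong (λ i → suc i % suc m) (Finₚ.toℕ-fromℕ< (m%n<n k (suc m))) ⟩
    (1 + k % suc m) % suc m                       ≡⟨ %-distribˡ-+ 1 (k % suc m) (suc m) ⟩
    (1 % suc m + k % suc m % suc m) % suc m       ≡⟨ cong (λ i → (1 % suc m + i) % suc m) (m%n%n≡m%n k (suc m)) ⟩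
    (1 % suc m + k % suc m) % suc m               ≡⟨ %-distribˡ-+ 1 k (suc m) ⟨
    suc k % suc m                                 ∎) _ _))
    where open ≡-Reasoning

  suc-standard : ∀ (i : Fin (suc m)) → iter standard (toℕ i) (suc zero) ≡ suc i
  suc-standard i = trans (iter-standard (toℕ i))
    (cong suc (Finₚ.toℕ-injective (trans (Finₚ.toℕ-fromℕ< _) (m<n⇒m%n≡m (Finₚ.toℕ<n i)))))

  standard-returns : ∀ x → iter (standard {m}) (suc m) x ≡ x
  standard-returns zero    = iter-fixed standard (suc m) refl
  standard-returns (suc i) = begin
    iter standard (suc m) (suc i)                          ≡⟨ cong (iter standard (suc m)) (suc-standard i) ⟨
    iter standard (suc m) (iter standard (toℕ i) (suc zero)) ≡⟨ iter-∘ standard (suc m) (toℕ i) (suc zero) ⟩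
    iter standard (toℕ i) (iter standard (suc m) (suc zero)) ≡⟨ cong (iter standard (toℕ i)) loop ⟩
    iter standard (toℕ i) (suc zero)                       ≡⟨ suc-standard i ⟩
    suc i                                                  ∎
    where
    open ≡-Reasoning
    loop : iter standard (suc m) (suc zero) ≡ suc zero
    loop = trans (iter-standard (suc m)) (cong suc (Finₚ.toℕ-injective (trans (Finₚ.toℕ-fromℕ< _) (n%n≡0 (suc m)))))

  standard-isRotation : IsRotation zero (standard {m})
  standard-isRotation = record
    { fixes        = refl
    ; injective    = λ x y e → trans (back x) (trans (cong (iter standard m) e) (sym (back y)))
    ; single-cycle = cycle
    }
    where
    open ≡-Reasoning
    back : ∀ x → x ≡ iter standard m (standard x)
    back x = sym (trans (iter-∘ standard m 1 x) (standard-returns x))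
    cycle : ∀ u w → u ≢ zero → w ≢ zero → ∃[ k ] iter standard k u ≡ w
    cycle zero    _       u≢ _  = contradiction refl u≢
    cycle (suc i) zero    _  w≢ = contradiction refl w≢
    -- From label 1 + i the cycle is completed to label 1 in `suc m ∸ toℕ i` steps; label 1 + j is
    -- then `toℕ j` steps further.
    cycle (suc i) (suc j) _  _  = toℕ j + (suc m ∸ toℕ i) , (begin
      iter standard (toℕ j + (suc m ∸ toℕ i)) (suc i)
        ≡⟨ iter-+ standard (toℕ j) (suc m ∸ toℕ i) (suc i) ⟩
      iter standard (toℕ j) (iter standard (suc m ∸ toℕ i) (suc i))
        ≡⟨ cong (iter standard (toℕ j) ∘ iter standard (suc m ∸ toℕ i)) (suc-standard i) ⟨
      iter standard (toℕ j) (iter standard (suc m ∸ toℕ i) (iter standard (toℕ i) (suc zero)))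
        ≡⟨ cong (iter standard (toℕ j)) (iter-return standard (ℕₚ.<⇒≤ (Finₚ.toℕ<n i)) (standard-returns (suc zero))) ⟩
      iter standard (toℕ j) (suc zero)
        ≡⟨ suc-standard j ⟩
      suc j ∎)

module _ (m : ℕ) where

  -- The m ! rotations at the vertex 1 of Fin (2 + m): 1 is the label of v and 0 that of r, and
  -- the cycle is read off starting at 0.
  letter : Fin (m !) → Fin (suc (suc m)) → Fin (suc (suc m))
  letter k = conjugate (swap (permute m k)) standard

  letter-isRotation : ∀ k → IsRotation (suc zero) (letter k)
  letter-isRotation k = conjugate-isRotation (swap (permute m k)) standard-isRotation

  iter-letter : ∀ k i → iter (letter k) i zero ≡ swap (permute m k) ⟨$⟩ʳ suc (fromℕ< (m%n<n i (suc m)))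
  iter-letter k i = trans (iter-conjugate (swap (permute m k)) standard i (suc zero))
                            (cong (swap (permute m k) ⟨$⟩ʳ_) (iter-standard i))

  -- Started at 0, the cycle of `letter k` shows 2 + `permute m k` i at time 1 + i, so the
  -- permutation can be read back.
  letter-injective : ∀ {k l} → letter k ≗ letter l → k ≡ l
  letter-injective {k} {l} e = permute-injective m λ i → Finₚ.suc-injective (Finₚ.suc-injective (begin
    swap (permute m k) ⟨$⟩ʳ suc (suc i)  ≡⟨ read k i ⟨
    iter (letter k) (suc (toℕ i)) zero ≡⟨ iter-cong (suc (toℕ i)) ⟩
    iter (letter l) (suc (toℕ i)) zero ≡⟨ read l i ⟩
    swap (permute m l) ⟨$⟩ʳ suc (suc i)  ∎))
    where
    open ≡-Reasoning
    iter-cong : ∀ j → iter (letter k) j zero ≡ iter (letter l) j zero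
    iter-cong zero    = refl
    iter-cong (suc j) = trans (cong (letter k) (iter-cong j)) (e (iter (letter l) j zero))
    read : ∀ k i → iter (letter k) (suc (toℕ i)) zero ≡ swap (permute m k) ⟨$⟩ʳ suc (suc i)
    read k i = trans (iter-letter k (suc (toℕ i))) (cong (λ j → swap (permute m k) ⟨$⟩ʳ suc j)
      (Finₚ.toℕ-injective (trans (Finₚ.toℕ-fromℕ< _) (m<n⇒m%n≡m (s≤s (Finₚ.toℕ<n i))))))

  letter-surjective : ∀ {f} → IsRotation (suc zero) f → ∃[ k ] letter k ≗ f
  letter-surjective {f} R = k , rotation-unique (letter-isRotation k) R 0≢1 λ i →
      trans (iter-letter k i) (trans (agree (fromℕ< (m%n<n i (suc m)))) (sym (iter-%-frame R 0≢1 i)))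
    where
    open ≡-Reasoning
    0≢1 : zero ≢ suc zero
    0≢1 ()
    -- The frame centred at 1 and started at 0 exchanges 0 and 1. Composing with the transposition
    -- fixes both, and deleting them leaves the permutation of m points to look up.
    π  = transpose zero (suc zero) ∘ₚ framing R 0≢1
    π₁ = remove zero π
    π₂ = remove zero π₁
    k = proj₁ (permute-surjective m π₂)
    agree : ∀ i → swap (permute m k) ⟨$⟩ʳ suc i ≡ frame f (suc zero) zero (suc i)
    agree zero    = refl
    agree (suc i) = begin
      suc (suc (permute m k ⟨$⟩ʳ i))  ≡⟨ cong (λ j → suc (suc j)) (proj₂ (permute-surjective m π₂) i) ⟩
      suc (lift₀ π₂ ⟨$⟩ʳ suc i)       ≡⟨ cong suc (Perm.lift₀-remove π₁ refl (suc i)) ⟩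
      lift₀ π₁ ⟨$⟩ʳ suc (suc i)       ≡⟨ Perm.lift₀-remove π refl (suc (suc i)) ⟩
      π ⟨$⟩ʳ suc (suc i)              ∎


-- The word of a map

module Coding {m : ℕ} (r : Fin (suc (suc m))) where

  private
    V : Set
    V = Fin (suc (suc m))

  rotation : (X : Map (suc (suc m))) → ∀ v → IsRotation v (rot X v)
  rotation (_ , S) v = record
    { fixes        = IsRotationSystem.fixes-centre S v
    ; injective    = IsRotationSystem.injective S v
    ; single-cycle = IsRotationSystem.single-cycle S v
    }

  frameAt : Map (suc (suc m)) → V → V → V
  frameAt X = frame (rot X r) r

  -- Conjugacy stated as a commuting square, because `frameAt X v` is invertible only for v off the
  -- root. In this form it can be transported along equations between vertices.
  HasLetter : Map (suc (suc m)) → V → Fin (m !) → Set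
  HasLetter X v k = ∀ x → rot X v (frameAt X v x) ≡ frameAt X v (letter m k x)

  module _ (X : Map (suc (suc m))) where

    hasLetter-unique : ∀ {v k l} → v ≢ r → HasLetter X v k → HasLetter X v l → k ≡ l
    hasLetter-unique v≢r h h′ = letter-injective m λ x →
      frame-injective (rotation X r) v≢r (trans (sym (h x)) (h′ x))

    abstract
      hasLetter-exists : ∀ {v} → v ≢ r → ∃ (HasLetter X v)
      hasLetter-exists {v} v≢r = proj₁ k , λ x → begin
        rot X v (F ⟨$⟩ʳ x)                            ≡⟨ inverseʳ F ⟨
        F ⟨$⟩ʳ (F ⟨$⟩ˡ rot X v (F ⟨$⟩ʳ x))            ≡⟨ cong (F ⟨$⟩ʳ_) (proj₂ k x) ⟨
        F ⟨$⟩ʳ letter m (proj₁ k) x                   ∎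
        where
        open ≡-Reasoning
        F : Permutation′ (suc (suc m))
        F = framing (rotation X r) v≢r
        k : ∃[ k ] letter m k ≗ conjugate (flip F) (rot X v)
        -- In the labels relative to v, the vertex v itself has label 1, so the conjugated rotation
        -- is centred at 1.
        k = letter-surjective m (subst (λ u → IsRotation u (conjugate (flip F) (rot X v))) (inverseˡ F {suc zero})
              (conjugate-isRotation (flip F) (rotation X v)))

    module _ {v : V} (v≢r : v ≢ r) where

      word : ℕ → Fin (m !)
      word i = proj₁ (hasLetter-exists (iter-≢ (rotation X r) i v≢r))

      word-hasLetter : ∀ i → HasLetter X (iter (rot X r) i v) (word i)
      word-hasLetter i = proj₂ (hasLetter-exists (iter-≢ (rotation X r) i v≢r))

      word-unique : ∀ {i k} → HasLetter X (iter (rot X r) i v) k → word i ≡ k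
      word-unique {i} = hasLetter-unique (iter-≢ (rotation X r) i v≢r) (word-hasLetter i)

    -- A letter depends only on the vertex reached, not on the starting point or on the proof of
    -- being off the root. This is what turns a change of starting vertex into a shift of the word.
    word-cong : ∀ {u v} (u≢r : u ≢ r) (v≢r : v ≢ r) {i j} →
                iter (rot X r) i u ≡ iter (rot X r) j v → word u≢r i ≡ word v≢r j
    word-cong u≢r v≢r {i} {j} e = word-unique u≢r {i}
      (subst (λ u → HasLetter X u (word v≢r j)) (sym e) (word-hasLetter v≢r j))

    word-periodic : ∀ {v} (v≢r : v ≢ r) → Periodic (suc m) (word v≢r)
    word-periodic {v} v≢r i = word-cong v≢r v≢r {suc m + i} {i} (trans
      (trans (iter-+ (rot X r) (suc m) i v) (iter-∘ (rot X r) (suc m) i v))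
      (cong (iter (rot X r) i) (returns (rotation-period (rotation X r) v≢r))))

  -- Isomorphisms, stated without inverses, and their effect on words.

  record Iso (γ : Permutation′ (suc (suc m))) (X Y : Map (suc (suc m))) : Set where
    field
      root     : FixesRoot r γ
      commutes : ∀ w x → rot Y (γ ⟨$⟩ʳ w) (γ ⟨$⟩ʳ x) ≡ γ ⟨$⟩ʳ rot X w x

  module _ {γ : Permutation′ (suc (suc m))} {X Y : Map (suc (suc m))} where

    act⇒Iso : FixesRoot r γ → (∀ w x → rot Y w x ≡ act γ (rot X) w x) → Iso γ X Y
    act⇒Iso root e = record { root = root ; commutes = λ w x →
      trans (e (γ ⟨$⟩ʳ w) (γ ⟨$⟩ʳ x)) (cong₂ (λ w x → γ ⟨$⟩ʳ rot X w x) (inverseˡ γ) (inverseˡ γ)) }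

    Iso⇒act : Iso γ X Y → ∀ w x → rot Y w x ≡ act γ (rot X) w x
    Iso⇒act iso w x = trans (sym (cong₂ (rot Y) (inverseʳ γ) (inverseʳ γ))) (Iso.commutes iso (γ ⟨$⟩ˡ w) (γ ⟨$⟩ˡ x))

    module _ (γ-root : ∀ x → rot Y r (γ ⟨$⟩ʳ x) ≡ γ ⟨$⟩ʳ rot X r x) where

      iter-equivariant : ∀ i v → γ ⟨$⟩ʳ iter (rot X r) i v ≡ iter (rot Y r) i (γ ⟨$⟩ʳ v)
      iter-equivariant zero    v = refl
      iter-equivariant (suc i) v = trans (sym (γ-root _)) (cong (rot Y r) (iter-equivariant i v))

      frame-equivariant : FixesRoot r γ → ∀ v x → γ ⟨$⟩ʳ frameAt X v x ≡ frameAt Y (γ ⟨$⟩ʳ v) x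
      frame-equivariant root v zero    = root
      frame-equivariant root v (suc i) = iter-equivariant (toℕ i) v

    module _ (iso : Iso γ X Y) where
      open Iso iso

      iso-root : ∀ x → rot Y r (γ ⟨$⟩ʳ x) ≡ γ ⟨$⟩ʳ rot X r x
      iso-root x = trans (cong (λ w → rot Y w (γ ⟨$⟩ʳ x)) (sym root)) (commutes r x)

      iso-≢ : ∀ {v} → v ≢ r → γ ⟨$⟩ʳ v ≢ r
      iso-≢ v≢r e = v≢r (⟨$⟩ʳ-injective γ (trans e (sym root)))

      -- γ commutes with the rotations at r, so it carries the labelling around v to the one around
      -- γ v; the rotation expressed in labels is unchanged.
      iso-hasLetter : ∀ {v k} → HasLetter X v k → HasLetter Y (γ ⟨$⟩ʳ v) k
      iso-hasLetter {v} {k} h x = begin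
        rot Y (γ ⟨$⟩ʳ v) (frameAt Y (γ ⟨$⟩ʳ v) x)  ≡⟨ cong (rot Y (γ ⟨$⟩ʳ v)) (frame-equivariant iso-root root v x) ⟨
        rot Y (γ ⟨$⟩ʳ v) (γ ⟨$⟩ʳ frameAt X v x)    ≡⟨ commutes v (frameAt X v x) ⟩
        γ ⟨$⟩ʳ rot X v (frameAt X v x)             ≡⟨ cong (γ ⟨$⟩ʳ_) (h x) ⟩
        γ ⟨$⟩ʳ frameAt X v (letter m k x)          ≡⟨ frame-equivariant iso-root root v (letter m k x) ⟩
        frameAt Y (γ ⟨$⟩ʳ v) (letter m k x)        ∎
        where open ≡-Reasoning

      iso-word : ∀ {v} (v≢r : v ≢ r) i → word Y (iso-≢ v≢r) i ≡ word X v≢r i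
      iso-word {v} v≢r i = word-unique Y (iso-≢ v≢r) {i} (subst (λ u → HasLetter Y u (word X v≢r i))
        (iter-equivariant iso-root i v) (iso-hasLetter (word-hasLetter X v≢r i)))

  module _ {X Y : Map (suc (suc m))} {v v′ : V} (v≢r : v ≢ r) (v′≢r : v′ ≢ r)
           (words : ∀ i → word X v≢r i ≡ word Y v′≢r i) where
    private
      F  = framing (rotation X r) v≢r
      F′ = framing (rotation Y r) v′≢r
      γ  = flip F ∘ₚ F′

      γ-frame : ∀ x → γ ⟨$⟩ʳ frameAt X v x ≡ frameAt Y v′ x
      γ-frame x = cong (F′ ⟨$⟩ʳ_) (inverseˡ F {x})

      γ-iter : ∀ i → γ ⟨$⟩ʳ iter (rot X r) i v ≡ iter (rot Y r) i v′
      γ-iter i = begin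
        γ ⟨$⟩ʳ iter (rot X r) i v                             ≡⟨ cong (γ ⟨$⟩ʳ_) (iter-%-frame (rotation X r) v≢r i) ⟩
        γ ⟨$⟩ʳ frameAt X v (suc (fromℕ< (m%n<n i (suc m))))  ≡⟨ γ-frame (suc (fromℕ< (m%n<n i (suc m)))) ⟩
        frameAt Y v′ (suc (fromℕ< (m%n<n i (suc m))))        ≡⟨ iter-%-frame (rotation Y r) v′≢r i ⟨
        iter (rot Y r) i v′                                   ∎
        where open ≡-Reasoning

      γ-root : ∀ x → rot Y r (γ ⟨$⟩ʳ x) ≡ γ ⟨$⟩ʳ rot X r x
      γ-root x with x Finₚ.≟ r
      ... | yes refl = begin
        rot Y r (γ ⟨$⟩ʳ r)   ≡⟨ cong (rot Y r) (γ-frame zero) ⟩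
        rot Y r r            ≡⟨ fixes (rotation Y r) ⟩
        r                    ≡⟨ γ-frame zero ⟨
        γ ⟨$⟩ʳ r             ≡⟨ cong (γ ⟨$⟩ʳ_) (fixes (rotation X r)) ⟨
        γ ⟨$⟩ʳ rot X r r     ∎
        where open ≡-Reasoning
      ... | no x≢r with single-cycle (rotation X r) v x v≢r x≢r
      ...   | i , refl = trans (cong (rot Y r) (γ-iter i)) (sym (γ-iter (suc i)))

      γ-commutes : ∀ w x → rot Y (γ ⟨$⟩ʳ w) (γ ⟨$⟩ʳ x) ≡ γ ⟨$⟩ʳ rot X w x
      γ-commutes w x with w Finₚ.≟ r
      ... | yes refl = trans (cong (λ u → rot Y u (γ ⟨$⟩ʳ x)) (γ-frame zero)) (γ-root x)
      ... | no  w≢r with single-cycle (rotation X r) v w v≢r w≢r | frame-surjective (rotation X r) w≢r x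
      ...   | i , refl | y , refl = begin
        rot Y (γ ⟨$⟩ʳ w) (γ ⟨$⟩ʳ frameAt X w y)      ≡⟨ cong (rot Y (γ ⟨$⟩ʳ w)) (γ-frameAt y) ⟩
        rot Y (γ ⟨$⟩ʳ w) (frameAt Y (γ ⟨$⟩ʳ w) y)    ≡⟨ letter-γw y ⟩
        frameAt Y (γ ⟨$⟩ʳ w) (letter m (word X v≢r i) y) ≡⟨ γ-frameAt (letter m (word X v≢r i) y) ⟨
        γ ⟨$⟩ʳ frameAt X w (letter m (word X v≢r i) y) ≡⟨ cong (γ ⟨$⟩ʳ_) (word-hasLetter X v≢r i y) ⟨
        γ ⟨$⟩ʳ rot X w (frameAt X w y)               ∎
        where
        open ≡-Reasoning
        γ-frameAt = frame-equivariant {γ} {X} {Y} γ-root (γ-frame zero) w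
        letter-γw : HasLetter Y (γ ⟨$⟩ʳ w) (word X v≢r i)
        letter-γw = subst₂ (HasLetter Y) (sym (γ-iter i)) (sym (words i)) (word-hasLetter Y v′≢r i)

    abstract
      -- γ sends each vertex to the one with the same label, relative to v in X and to v′ in Y. It
      -- therefore commutes with the rotations at r and respects the labels relative to every other
      -- vertex too, so equal letters make it commute with the remaining rotations.
      word-iso : ∃[ γ ] Iso γ X Y × γ ⟨$⟩ʳ v ≡ v′
      word-iso = γ , record { root = γ-frame zero ; commutes = γ-commutes } , γ-frame (suc zero)

  base : V
  base = punchIn r zero

  base≢r : base ≢ r
  base≢r = Finₚ.punchInᵢ≢i r zero

  letters : Fin ((m !) ^ suc m) → ℕ → Fin (m !)
  letters = at {m !} {suc m}

  rotate : Fin ((m !) ^ suc m) → Fin ((m !) ^ suc m)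
  rotate = shift {m !} {suc m}

  code : Map (suc (suc m)) → Fin ((m !) ^ suc m)
  code X = encode {m !} {suc m} (word X base≢r)

  at-code : ∀ X i → letters (code X) i ≡ word X base≢r i
  at-code X = at-encode {m !} {suc m} {word X base≢r} (word-periodic X base≢r)

  at-shift-code : ∀ X a i → letters (iter rotate a (code X)) i
                          ≡ word X (iter-≢ (rotation X r) a base≢r) i
  at-shift-code X a i = begin
    letters (iter rotate a (code X)) i   ≡⟨ at-iter-shift {m !} {suc m} a (code X) i ⟩
    letters (code X) (a + i)          ≡⟨ at-code X (a + i) ⟩
    word X base≢r (a + i)                      ≡⟨ word-cong X base≢r (iter-≢ (rotation X r) a base≢r) {a + i} {i}
                                                    (trans (iter-+ (rot X r) a i base) (iter-∘ (rot X r) a i base)) ⟩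
    word X (iter-≢ (rotation X r) a base≢r) i  ∎
    where open ≡-Reasoning

  -- The word of Y read from γ `base` is the word of X by invariance of letters, and the a-th shift
  -- of the code of Y because γ `base` lies a steps beyond `base`.
  Iso⇒shift : ∀ {γ X Y a} → Iso γ X Y → iter (rot Y r) a base ≡ γ ⟨$⟩ʳ base → iter rotate a (code Y) ≡ code X
  Iso⇒shift {γ} {X} {Y} {a} iso e = at-injective {m !} {suc m} λ i → begin
    letters (iter rotate a (code Y)) i   ≡⟨ at-shift-code Y a i ⟩
    word Y (iter-≢ (rotation Y r) a base≢r) i  ≡⟨ word-cong Y (iter-≢ (rotation Y r) a base≢r) (iso-≢ iso base≢r) {i} {i}
                                                    (cong (iter (rot Y r) i) e) ⟩
    word Y (iso-≢ iso base≢r) i                ≡⟨ iso-word iso base≢r i ⟩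
    word X base≢r i                            ≡⟨ at-code X i ⟨
    letters (code X) i                ∎
    where open ≡-Reasoning

  shift⇒Iso : ∀ {X Y} a → iter rotate a (code Y) ≡ code X → ∃[ γ ] Iso γ X Y × γ ⟨$⟩ʳ base ≡ iter (rot Y r) a base
  shift⇒Iso {X} {Y} a e = word-iso base≢r (iter-≢ (rotation Y r) a base≢r) λ i →
    trans (sym (at-code X i)) (trans (cong (λ x → letters x i) (sym e)) (at-shift-code Y a i))

  -- Realization of a word by a map.

  private
    standardRoot : V → V
    standardRoot = conjugate (insert zero r Perm.id) standard

    standardRoot-isRotation : IsRotation r standardRoot
    standardRoot-isRotation = conjugate-isRotation (insert zero r Perm.id) standard-isRotation

    iter-standardRoot : ∀ i → iter standardRoot i base ≡ punchIn r (fromℕ< (m%n<n i (suc m)))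
    iter-standardRoot i = trans (iter-conjugate (insert zero r Perm.id) standard i (suc zero))
                                  (cong (insert zero r Perm.id ⟨$⟩ʳ_) (iter-standard i))

    module Realize (x : Fin ((m !) ^ suc m)) where

      -- The j-th iterate of `base` under `standardRoot` is `punchIn r j` for j ≤ m, so `punchOut`
      -- recovers the position in the word.
      letterOf : ∀ {v} → v ≢ r → Fin (m !)
      letterOf v≢r = letters x (toℕ (punchOut (v≢r ∘ sym)))

      -- The decision is an argument, so that properties of the realized map can be proved by cases
      -- on it.
      choose : ∀ v → Dec (v ≡ r) → V → V
      choose v (yes _)   = standardRoot
      choose v (no v≢r)  = conjugate (framing standardRoot-isRotation v≢r) (letter m (letterOf v≢r))

      choose-isRotation : ∀ v d → IsRotation v (choose v d)
      choose-isRotation v (yes refl) = standardRoot-isRotation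
      choose-isRotation v (no v≢r)     =
        conjugate-isRotation (framing standardRoot-isRotation v≢r) (letter-isRotation m (letterOf v≢r))

      realization : Map (suc (suc m))
      realization = (λ v → choose v (v Finₚ.≟ r)) , record
        { fixes-centre = λ v → fixes (choose-isRotation v (v Finₚ.≟ r))
        ; injective    = λ v → injective (choose-isRotation v (v Finₚ.≟ r))
        ; single-cycle = λ v → single-cycle (choose-isRotation v (v Finₚ.≟ r))
        }

      choose-root : ∀ d → choose r d ≡ standardRoot
      choose-root (yes _)  = refl
      choose-root (no r≢r) = contradiction refl r≢r

      letterOf-iter : ∀ i (≢r : iter standardRoot i base ≢ r) → letterOf ≢r ≡ letters x i
      letterOf-iter i ≢r = begin
        letters x (toℕ (punchOut (≢r ∘ sym)))
          ≡⟨ cong (letters x ∘ toℕ) (Finₚ.punchOut-cong r {i≢k = Finₚ.punchInᵢ≢i r _ ∘ sym} (iter-standardRoot i)) ⟩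
        letters x (toℕ (punchOut (Finₚ.punchInᵢ≢i r (fromℕ< (m%n<n i (suc m))) ∘ sym)))
          ≡⟨ cong (letters x ∘ toℕ) (Finₚ.punchOut-punchIn r) ⟩
        letters x (toℕ (fromℕ< (m%n<n i (suc m))))
          ≡⟨ cong (letters x) (Finₚ.toℕ-fromℕ< (m%n<n i (suc m))) ⟩
        letters x (i % suc m)
          ≡⟨ periodic-% {w = letters x} (at-periodic {m !} {suc m} x) i ⟩
        letters x i ∎
        where open ≡-Reasoning

      choose-letter : ∀ i d y → let v = iter standardRoot i base in
        choose v d (frame standardRoot r v y) ≡ frame standardRoot r v (letter m (letters x i) y)
      choose-letter i (yes ≡r) y = contradiction ≡r (iter-≢ standardRoot-isRotation i base≢r)
      choose-letter i (no ≢r)  y = trans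
        (cong (λ z → F ⟨$⟩ʳ letter m (letterOf ≢r) z) (inverseˡ F {y}))
        (cong (λ k → F ⟨$⟩ʳ letter m k y) (letterOf-iter i ≢r))
        where F = framing standardRoot-isRotation ≢r

      hasLetters : ∀ i → HasLetter realization (iter (rot realization r) i base) (letters x i)
      -- The root rotation of `realization` is `choose r (r ≟ r)`, equal to `standardRoot` only
      -- propositionally; the statement is transported along that equation.
      hasLetters = subst (λ f → ∀ i y → rot realization (iter f i base) (frame f r (iter f i base) y)
                                      ≡ frame f r (iter f i base) (letter m (letters x i) y))
        (sym (choose-root (r Finₚ.≟ r))) (λ i → choose-letter i (iter standardRoot i base Finₚ.≟ r))

  realize : Fin ((m !) ^ suc m) → Map (suc (suc m))
  realize = Realize.realization

  code-realize : ∀ x → code (realize x) ≡ x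
  code-realize x = at-injective {m !} {suc m} {code (realize x)} {x} λ i →
    trans (at-code (realize x) i) (word-unique (realize x) base≢r {i} (Realize.hasLetters x i))


-- Symmetric maps

module Symmetry {m : ℕ} (r : Fin (suc (suc m))) where
  open Coding {m} r public

  module _ (X : Map (suc (suc m))) where
    private
      f = rot X r

      off-period : ∀ {v} → v ≢ r → Period f v (suc m)
      off-period = rotation-period (rotation X r)

    -- Automorphisms commute with the rotation at the root, so off the root they are its powers.
    IsPower : ℕ → Permutation′ (suc (suc m)) → Set
    IsPower a γ = ∀ {v} → v ≢ r → γ ⟨$⟩ʳ v ≡ iter f a v

    iter-power : ∀ {a γ} → IsPower a γ → ∀ i {v} → v ≢ r → iter (γ ⟨$⟩ʳ_) i v ≡ iter f (i * a) v
    iter-power {a} {γ} pw zero    v≢r = refl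
    iter-power {a} {γ} pw (suc i) {v} v≢r = begin
      γ ⟨$⟩ʳ iter (γ ⟨$⟩ʳ_) i v   ≡⟨ cong (γ ⟨$⟩ʳ_) (iter-power {a} {γ} pw i v≢r) ⟩
      γ ⟨$⟩ʳ iter f (i * a) v     ≡⟨ pw (iter-≢ (rotation X r) (i * a) v≢r) ⟩
      iter f a (iter f (i * a) v) ≡⟨ iter-+ f a (i * a) v ⟨
      iter f (a + i * a) v        ∎
      where open ≡-Reasoning

    -- γ commutes with the rotation at r, and that rotation reaches every other vertex from `base`,
    -- so the image of `base` decides everything.
    iso-power : ∀ {γ a} → Iso γ X X → γ ⟨$⟩ʳ base ≡ iter f a base → IsPower a γ
    iso-power {γ} {a} iso e {v} v≢r with single-cycle (rotation X r) base v base≢r v≢r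
    ... | i , refl = begin
      γ ⟨$⟩ʳ iter f i base     ≡⟨ iter-equivariant {γ} {X} {X} (iso-root iso) i base ⟩
      iter f i (γ ⟨$⟩ʳ base)   ≡⟨ cong (iter f i) e ⟩
      iter f i (iter f a base) ≡⟨ iter-∘ f i a base ⟩
      iter f a (iter f i base) ∎
      where open ≡-Reasoning

    aut⇒Iso : ∀ {γ} → IsAut r X γ → Iso γ X X
    aut⇒Iso {γ} (root , e) = act⇒Iso {γ} {X} {X} root (λ w x → sym (e w x))

    abstract
      aut⇒power : ∀ {γ} → IsAut r X γ → ∃[ a ] IsPower a γ × iter rotate a (code X) ≡ code X
      aut⇒power {γ} aut =
        let iso = aut⇒Iso {γ} aut
            a , e = single-cycle (rotation X r) base (γ ⟨$⟩ʳ base) base≢r (iso-≢ iso base≢r)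
        in a , iso-power {γ} {a} iso (sym e) , Iso⇒shift {γ} {X} {X} {a} iso e

      shift⇒aut : ∀ a → iter rotate a (code X) ≡ code X → ∃[ γ ] IsAut r X γ × IsPower a γ
      shift⇒aut a e =
        let γ , iso , γ-base = shift⇒Iso {X} {X} a e
        in γ , (Iso.root iso , λ w x → sym (Iso⇒act {γ} {X} {X} iso w x)) , iso-power {γ} {a} iso γ-base

    module _ {q d : ℕ} (m≡qd : suc m ≡ q * d) where

      dq≡m : d * q ≡ suc m
      dq≡m = trans (ℕₚ.*-comm d q) (sym m≡qd)

      module _ (P : Period rotate (code X) q) {g : Permutation′ (suc (suc m))}
        (g-root : FixesRoot r g) (g-power : IsPower q g) where

        generates : ∀ {γ a} → FixesRoot r γ → IsPower a γ → (q∣a : q ∣ a) → ∀ x → γ ⟨$⟩ʳ x ≡ iter (g ⟨$⟩ʳ_) (quotient q∣a) x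
        generates {γ} {a} γ-root γ-power q∣a x with x Finₚ.≟ r
        ... | no  x≢r = begin
          γ ⟨$⟩ʳ x                          ≡⟨ γ-power x≢r ⟩
          iter f a x                        ≡⟨ cong (λ i → iter f i x) (m∣n⇒n≡quotient*m q∣a) ⟩
          iter f (quotient q∣a * q) x       ≡⟨ iter-power {q} {g} g-power (quotient q∣a) x≢r ⟨
          iter (g ⟨$⟩ʳ_) (quotient q∣a) x   ∎
          where open ≡-Reasoning
        ... | yes x≡r = subst (λ x → γ ⟨$⟩ʳ x ≡ iter (g ⟨$⟩ʳ_) (quotient q∣a) x) (sym x≡r)
          (trans γ-root (sym (iter-fixed (g ⟨$⟩ʳ_) (quotient q∣a) g-root)))

        order : ∀ v → v ≢ r → iter (g ⟨$⟩ʳ_) d v ≡ v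
        order v v≢r = begin
          iter (g ⟨$⟩ʳ_) d v  ≡⟨ iter-power {q} {g} g-power d v≢r ⟩
          iter f (d * q) v    ≡⟨ cong (λ i → iter f i v) dq≡m ⟩
          iter f (suc m) v    ≡⟨ returns (off-period v≢r) ⟩
          v                   ∎
          where open ≡-Reasoning

        faithful : ∀ v → v ≢ r → ∀ j → 0 < j → j < d → iter (g ⟨$⟩ʳ_) j v ≢ v
        faithful v v≢r j 0<j j<d e = minimal (off-period v≢r) (j * q)
          (ℕₚ.*-mono-< 0<j (positive P))
          (subst (j * q <_) dq≡m (ℕₚ.*-monoˡ-< q {{nonZero P}} j<d))
          (trans (sym (iter-power {q} {g} g-power j v≢r)) e)

      -- The generator is the automorphism acting as ρᵣ^q. Any other acts as ρᵣ^a with the a-th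
      -- shift fixing the code, so q ∣ a. Its cycles off r have length d because those of ρᵣ have
      -- length q d.
      Period⇒DFold : Period rotate (code X) q → DFoldSymmetric r d X
      Period⇒DFold P =
        let g , g-aut , g-power = shift⇒aut q (returns P) in
        g , g-aut
          , (λ γ γ-aut → let a , γ-power , fixed = aut⇒power {γ} γ-aut
                             q∣a = period-∣ P fixed
                         in quotient q∣a , generates P {g} (proj₁ g-aut) g-power {γ} {a} (proj₁ γ-aut) γ-power q∣a)
          , (λ v v≢r → order P {g} (proj₁ g-aut) g-power v v≢r , faithful P {g} (proj₁ g-aut) g-power v v≢r)

      module _ {p} (P : Period rotate (code X) p) {g h : Permutation′ (suc (suc m))} {a j b s : ℕ}
        (orders : ∀ v → v ≢ r → iter (g ⟨$⟩ʳ_) d v ≡ v × (∀ j → 0 < j → j < d → iter (g ⟨$⟩ʳ_) j v ≢ v))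
        (g-power : IsPower a g) (h-power : IsPower p h) (h≗g^j : ∀ x → h ⟨$⟩ʳ x ≡ iter (g ⟨$⟩ʳ_) j x)
        (a≡bp : a ≡ b * p) (m≡sp : suc m ≡ s * p) where

        open ≡-Reasoning

        instance
          p≢0 : NonZero p
          p≢0 = nonZero P
          s≢0 : NonZero s
          s≢0 = ∣⇒nonZero {s} {suc m} (divides p (trans m≡sp (ℕₚ.*-comm s p)))
          d≢0 : NonZero d
          d≢0 = ∣⇒nonZero {d} {suc m} (divides q m≡qd)

        h^i≗g^ij : ∀ i x → iter (h ⟨$⟩ʳ_) i x ≡ iter (g ⟨$⟩ʳ_) (i * j) x
        h^i≗g^ij i x = trans (iter-cong i) (iter-iter (g ⟨$⟩ʳ_) i j x)
          where
          iter-cong : ∀ i → iter (h ⟨$⟩ʳ_) i x ≡ iter (iter (g ⟨$⟩ʳ_) j) i x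
          iter-cong zero    = refl
          iter-cong (suc i) = trans (h≗g^j (iter (h ⟨$⟩ʳ_) i x)) (cong (iter (g ⟨$⟩ʳ_) j) (iter-cong i))

        -- h is a power of g, whose d-th power fixes `base`, and h^d acts as ρᵣ^(d p).
        m∣dp : suc m ∣ d * p
        m∣dp = period-∣ (off-period base≢r) (begin
          iter f (d * p) base            ≡⟨ iter-power {p} {h} h-power d base≢r ⟨
          iter (h ⟨$⟩ʳ_) d base          ≡⟨ h^i≗g^ij d base ⟩
          iter (g ⟨$⟩ʳ_) (d * j) base    ≡⟨ iter-∣ (g ⟨$⟩ʳ_) {d} {d * j} {base} (m∣m*n j) (proj₁ (orders base base≢r)) ⟩
          base                           ∎)

        -- The exponent a = b p of g gives s a = b (s p): g^s makes b full turns of ρᵣ.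
        g^s : iter (g ⟨$⟩ʳ_) s base ≡ base
        g^s = begin
          iter (g ⟨$⟩ʳ_) s base  ≡⟨ iter-power {a} {g} g-power s base≢r ⟩
          iter f (s * a) base    ≡⟨ iter-∣ f (divides b sa≡bm) (returns (off-period base≢r)) ⟩
          base                   ∎
          where
          sa≡bm : s * a ≡ b * suc m
          sa≡bm = begin
            s * a        ≡⟨ cong (s *_) a≡bp ⟩
            s * (b * p)  ≡⟨ ℕₚ.*-assoc s b p ⟨
            s * b * p    ≡⟨ cong (_* p) (ℕₚ.*-comm s b) ⟩
            b * s * p    ≡⟨ ℕₚ.*-assoc b s p ⟩
            b * (s * p)  ≡⟨ cong (b *_) m≡sp ⟨
            b * suc m    ∎

        d≤s : d ≤ s
        d≤s = ℕₚ.≮⇒≥ λ s<d → proj₂ (orders base base≢r) s (ℕ.>-nonZero⁻¹ s) s<d g^s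

        s≤d : s ≤ d
        s≤d = ℕₚ.*-cancelʳ-≤ s d p (ℕₚ.≤-trans (ℕₚ.≤-reflexive (sym m≡sp)) (∣⇒≤ {{ℕₚ.m*n≢0 d p}} m∣dp))

        p≡q : p ≡ q
        p≡q = ℕₚ.*-cancelˡ-≡ p q d (begin
          d * p  ≡⟨ cong (_* p) (ℕₚ.≤-antisym d≤s s≤d) ⟩
          s * p  ≡⟨ m≡sp ⟨
          suc m  ≡⟨ m≡qd ⟩
          q * d  ≡⟨ ℕₚ.*-comm q d ⟩
          d * q  ∎)

      -- The given generator g acts as some ρᵣ^a with a a multiple of the true period p, while the
      -- automorphism h acting as ρᵣ^p is a power of g. The first fact bounds the order d of g by (n
      -- - 1)/p, the second gives the reverse bound, and p = q follows.
      DFold⇒Period : DFoldSymmetric r d X → Period rotate (code X) q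
      DFold⇒Period (g , g-aut , generates , orders) =
        let p , P = period Finₚ._≟_ (suc m) (shift^m {m !} {suc m} (code X))
            a , g-power , g-fixed = aut⇒power {g} g-aut
            h , h-aut , h-power = shift⇒aut p (returns P)
            j , h≗g^j = generates h h-aut
            p∣a = period-∣ P g-fixed
            p∣m = period-∣ P (shift^m {m !} {suc m} (code X))
        in subst (Period rotate (code X))
             (p≡q P {g} {h} {a} {j} {quotient p∣a} {quotient p∣m} orders g-power h-power h≗g^j
               (m∣n⇒n≡quotient*m p∣a) (m∣n⇒n≡quotient*m p∣m)) P

  -- Transversals of maps, transversals of words, and their size.

  open Orbits {(m !) ^ suc m} {suc m} rotate (shift^m {m !} {suc m})
    using (_~_; ~-sym; IsTransversal; transversal; transversal-length; count-withPeriod; withPeriod; fixedBy)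

  Equivalent⇒~ : ∀ X Y → Equivalent r X Y → code X ~ code Y
  Equivalent⇒~ X Y (γ , root , e) =
    let iso = act⇒Iso {γ} {X} {Y} root e
        a , γ-base = single-cycle (rotation Y r) base (γ ⟨$⟩ʳ base) base≢r (iso-≢ iso base≢r)
    in ~-sym {code Y} {code X} (a , Iso⇒shift {γ} {X} {Y} {a} iso γ-base)

  ~⇒Equivalent : ∀ X Y → code X ~ code Y → Equivalent r X Y
  ~⇒Equivalent X Y x~y =
    let a , e = ~-sym {code X} {code Y} x~y
        γ , iso , _ = shift⇒Iso {X} {Y} a e
    in γ , Iso.root iso , Iso⇒act {γ} {X} {Y} iso

  module _ {q d : ℕ} (m≡qd : suc m ≡ q * d) where

    orbitTransversal : Σ (List (Map (suc (suc m)))) (IsOrbitTransversal r d)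
    orbitTransversal with transversal q
    ... | L , T = map realize L , record
      { members-sym  = Allₚ.map⁺ (All.map (λ {x} P → Period⇒DFold (realize x) m≡qd
                         (subst (λ y → Period rotate y q) (sym (code-realize x)) P)) (IsTransversal.periods T))
      ; inequivalent = AllPairsₚ.map⁺ (AllPairs.map (λ {x} {y} x≁y e → x≁y
                         (subst₂ _~_ (code-realize x) (code-realize y) (Equivalent⇒~ (realize x) (realize y) e)))
                       (IsTransversal.apart T))
      ; covering     = λ X sym-X → Anyₚ.map⁺ (Any.map (λ {x} x~X → ~⇒Equivalent X (realize x)
                         (subst (code X ~_) (sym (code-realize x)) (~-sym {x} {code X} x~X)))
                         (IsTransversal.covering T (code X) (DFold⇒Period X m≡qd sym-X)))
      }

    -- Allows an arbitrary transversal of maps to be counted, not only the one constructed. Every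
    -- word is the code of its realization, so covering all symmetric maps covers all words of
    -- period q.
    codeTransversal : ∀ {L} → IsOrbitTransversal r d L → IsTransversal q (map code L)
    codeTransversal T = record
      { periods  = Allₚ.map⁺ (All.map (λ {X} → DFold⇒Period X m≡qd) members-sym)
      ; apart    = AllPairsₚ.map⁺ (AllPairs.map (λ {X} {Y} X≁Y → X≁Y ∘ ~⇒Equivalent X Y) inequivalent)
      ; covering = λ x P → Anyₚ.map⁺ (Any.map (λ {X} e → ~-sym {x} {code X}
                     (subst (_~ code X) (code-realize x) (Equivalent⇒~ (realize x) X e)))
                     (covering (realize x) (Period⇒DFold (realize x) m≡qd
                       (subst (λ y → Period rotate y q) (sym (code-realize x)) P))))
      }
      where open IsOrbitTransversal T

    count : ∀ L → IsOrbitTransversal r d L → + (suc m * length L) ≡ mobiusSum (suc (suc m)) d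
    count L T = begin
      + (suc m * length L)               ≡⟨ cong +_ lengths ⟩
      + (d * length (withPeriod q))      ≡⟨ ℤₚ.pos-* d (length (withPeriod q)) ⟩
      + d ℤ.* + length (withPeriod q)    ≡⟨ cong (+ d ℤ.*_) (count-withPeriod m≡qd) ⟩
      + d ℤ.* ∑ (λ k → μ (k div d) ℤ.* + length (fixedBy (suc m div k))) (intermediate d (suc m))
        ≡⟨ cong (+ d ℤ.*_) (∑-cong-∈ (intermediate d (suc m)) (λ {k} k∈ → cong (λ l → μ (k div d) ℤ.* + l) (fixed k∈))) ⟩
      mobiusSum (suc (suc m)) d          ∎
      where
      open ≡-Reasoning
      -- Since n - 1 = d q, one factor q turns orbits into words and the factor d remains; no
      -- division occurs.
      lengths : suc m * length L ≡ d * length (withPeriod q)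
      lengths = begin
        suc m * length L             ≡⟨ cong₂ _*_ (trans m≡qd (ℕₚ.*-comm q d)) (sym (length-map code L)) ⟩
        d * q * length (map code L)  ≡⟨ ℕₚ.*-assoc d q _ ⟩
        d * (q * length (map code L)) ≡⟨ cong (d *_) (ℕₚ.*-comm q _) ⟩
        d * (length (map code L) * q) ≡⟨ cong (d *_) (transversal-length (codeTransversal T)) ⟩
        d * length (withPeriod q)    ∎
      fixed : ∀ {k} → k ∈ intermediate d (suc m) → length (fixedBy (suc m div k)) ≡ (m !) ^ (suc m div k)
      fixed {k} k∈ with ∈-intermediate⁻ {d} {suc m} k∈
      ... | _ , k∣m@(divides l m≡lk) =
        length-fixedBy {m !} {suc m} {{_}} {{∣⇒nonZero {suc m div k} {suc m} quotient∣}} quotient∣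
        where
        instance
          k≢0 : NonZero k
          k≢0 = ∣⇒nonZero {k} {suc m} k∣m
        m≡kl : suc m ≡ k * l
        m≡kl = trans m≡lk (ℕₚ.*-comm l k)
        quotient∣ : suc m div k ∣ suc m
        quotient∣ = divides k (trans m≡kl (cong (k *_) (sym (trans (cong (_div k) m≡kl) (*-div k l)))))

theorem15 : (n : ℕ) → 2 ≤ n → (r : Fin n) → (d : ℕ) → d ∣ n ∸ 1 →
    Σ (List (Map n)) (IsOrbitTransversal r d)
    × ((L : List (Map n)) → IsOrbitTransversal r d L →
    + ((n ∸ 1) * length L) ≡ mobiusSum n d)
theorem15 (suc zero)    (s≤s ())
-- The quotient q = (n - 1)/d is the least period that d-fold symmetry forces on the word.
theorem15 (suc (suc m)) _ r d (divides q m≡qd) =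
  Symmetry.orbitTransversal r {q} {d} m≡qd , Symmetry.count r {q} {d} m≡qd
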